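{- In general, the maximum of $|\det A|$ over $n\times n$ circulant matrices $A$ with real entries in $[0,1]$ is not attained at an extreme point of the cube $[0,1]^n$ of first rows. Specifically: (1) For $n = 9$, let $A(x) := \mathrm{circ}(x,0,0,1,1,1,1,0,1)$. Then $\det A(0) = 95 = D_{01}(9)$, the derivative of $\det A(x)$ with respect to $x$ at $x=0$ equals $9$, and $|\det A(0.241)| > 96.757$; hence $\max\{|\det \mathrm{circ}(a)| : a \in [0,1]^9\} > D_{01}(9)$. (2) For $n=10$, let $A(x) := \mathrm{circ}(x,0,1,0,0,1,1,1,1,0)$. Then $\det A(0) = 275 = D_{01}(10)$ and $\det A(0.112) > 279.4$; hence $\max\{|\det \mathrm{circ}(a)| : a \in [0,1]^{10}\} > D_{01}(10)$.
   Context: For a positive integer $n$, $\mathrm{circ}(a_0,\ldots,a_{n-1})$ denotes the $n\times n$ circulant matrix $(a_{(k-j)\bmod n})_{0\le j,k<n}$, whose first row is $a = (a_0,\ldots,a_{n-1})$. $D_{01}(n)$ denotes the maximum of $|\det B|$ over all $n \times n$ circulant matrices $B$ with entries in $\{0,1\}$, i.e. the maximum of $|\det\mathrm{circ}(a)|$ over the extreme points $a\in\{0,1\}^n$ of the cube $[0,1]^n$. -}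

module Defs where

open import Level using (0ℓ)
open import Algebra.Bundles.Raw using (RawRing)
open import Axiom.ExcludedMiddle using (ExcludedMiddle)
import Algebra.Definitions.RawSemiring as RawSemiringDefs
open import Data.Nat.Base as ℕ using (ℕ; zero; suc; NonZero)
import Data.Nat.Properties as ℕ
open import Data.Nat.DivMod using (_mod_)
open import Data.Fin.Base using (Fin; zero; suc; toℕ; punchIn)
open import Data.Rational.Base as ℚ using (ℚ; 0ℚ; 1ℚ; ½)
import Data.Rational.Properties as ℚ
open import Data.Rational.Solver using (module +-*-Solver)
open import Data.Product.Base using (∃; _×_; _,_)
open import Data.Sum.Base using (_⊎_; inj₁; inj₂)
open import Data.Vec.Functional using (Vector)
open import Relation.Nullary.Negation.Core using (¬_)
open import Relation.Binary.PropositionalEquality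
  using (_≡_; refl; sym; trans; cong; cong₂; subst; module ≡-Reasoning)

------------------------------------------------------------------------
-- Real numbers: Cauchy sequences of rationals (with modulus), taken up
-- to the setoid equality _≃_ below

IsCauchy : (ℕ → ℚ) → Set
IsCauchy x = ∀ (ε : ℚ) → 0ℚ ℚ.< ε →
  ∃ λ N → ∀ m n → N ℕ.≤ m → N ℕ.≤ n → ℚ.∣ x m ℚ.- x n ∣ ℚ.< ε

record ℝ : Set where
  constructor mkℝ
  field
    seq    : ℕ → ℚ
    cauchy : IsCauchy seq

open ℝ public

private abstract
  halve : ∀ ε → 0ℚ ℚ.< ε → 0ℚ ℚ.< ½ ℚ.* ε
  halve ε 0<ε = ℚ.positive⁻¹ (½ ℚ.* ε) {{ℚ.pos*pos⇒pos ½ ε {{ℚ.positive 0<ε}}}}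

  halves : ∀ ε → ½ ℚ.* ε ℚ.+ ½ ℚ.* ε ≡ ε
  halves ε = trans (sym (ℚ.*-distribʳ-+ ε ½ ½)) (ℚ.*-identityˡ ε)

  bounded : ∀ x → IsCauchy x →
    ∃ λ B → 0ℚ ℚ.< B × ∃ λ N → ∀ n → N ℕ.≤ n → ℚ.∣ x n ∣ ℚ.≤ B
  bounded x cx with cx 1ℚ (ℚ.positive⁻¹ 1ℚ)
  ... | N , close = B , 0<B , N , bound
    where
    B : ℚ
    B = 1ℚ ℚ.+ ℚ.∣ x N ∣

    0<B : 0ℚ ℚ.< B
    0<B = ℚ.+-mono-<-≤ (ℚ.positive⁻¹ 1ℚ) (ℚ.0≤∣p∣ (x N))

    split : ∀ p q → p ≡ (p ℚ.- q) ℚ.+ q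
    split = solve 2 (λ p q → p := (p :- q) :+ q) refl
      where open +-*-Solver

    bound : ∀ n → N ℕ.≤ n → ℚ.∣ x n ∣ ℚ.≤ B
    bound n N≤n = begin
      ℚ.∣ x n ∣                          ≡⟨ cong ℚ.∣_∣ (split (x n) (x N)) ⟩
      ℚ.∣ (x n ℚ.- x N) ℚ.+ x N ∣        ≤⟨ ℚ.∣p+q∣≤∣p∣+∣q∣ (x n ℚ.- x N) (x N) ⟩
      ℚ.∣ x n ℚ.- x N ∣ ℚ.+ ℚ.∣ x N ∣    ≤⟨ ℚ.+-monoˡ-≤ ℚ.∣ x N ∣ (ℚ.<⇒≤ (close n N N≤n ℕ.≤-refl)) ⟩
      B                                  ∎
      where open ℚ.≤-Reasoning

  +-cauchy : ∀ x y → IsCauchy x → IsCauchy y → IsCauchy (λ n → x n ℚ.+ y n)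
  +-cauchy x y cx cy ε 0<ε
    with cx (½ ℚ.* ε) (halve ε 0<ε) | cy (½ ℚ.* ε) (halve ε 0<ε)
  ... | N₁ , close₁ | N₂ , close₂ = N₁ ℕ.⊔ N₂ , close
    where
    regroup : ∀ a b c d → (a ℚ.+ b) ℚ.- (c ℚ.+ d) ≡ (a ℚ.- c) ℚ.+ (b ℚ.- d)
    regroup = solve 4 (λ a b c d → (a :+ b) :- (c :+ d) := (a :- c) :+ (b :- d)) refl
      where open +-*-Solver

    close : ∀ m n → N₁ ℕ.⊔ N₂ ℕ.≤ m → N₁ ℕ.⊔ N₂ ℕ.≤ n →
            ℚ.∣ (x m ℚ.+ y m) ℚ.- (x n ℚ.+ y n) ∣ ℚ.< ε
    close m n N≤m N≤n = begin-strict
      ℚ.∣ (x m ℚ.+ y m) ℚ.- (x n ℚ.+ y n) ∣        ≡⟨ cong ℚ.∣_∣ (regroup (x m) (y m) (x n) (y n)) ⟩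
      ℚ.∣ (x m ℚ.- x n) ℚ.+ (y m ℚ.- y n) ∣        ≤⟨ ℚ.∣p+q∣≤∣p∣+∣q∣ (x m ℚ.- x n) (y m ℚ.- y n) ⟩
      ℚ.∣ x m ℚ.- x n ∣ ℚ.+ ℚ.∣ y m ℚ.- y n ∣      <⟨ ℚ.+-mono-<
        (close₁ m n (ℕ.m⊔n≤o⇒m≤o N₁ N₂ N≤m) (ℕ.m⊔n≤o⇒m≤o N₁ N₂ N≤n))
        (close₂ m n (ℕ.m⊔n≤o⇒n≤o N₁ N₂ N≤m) (ℕ.m⊔n≤o⇒n≤o N₁ N₂ N≤n)) ⟩
      ½ ℚ.* ε ℚ.+ ½ ℚ.* ε                          ≡⟨ halves ε ⟩
      ε                                            ∎
      where open ℚ.≤-Reasoning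

  neg-cauchy : ∀ x → IsCauchy x → IsCauchy (λ n → ℚ.- x n)
  neg-cauchy x cx ε 0<ε with cx ε 0<ε
  ... | N , close = N , λ m n N≤m N≤n → subst (ℚ._< ε) (flip m n) (close m n N≤m N≤n)
    where
    regroup : ∀ p q → ℚ.- (p ℚ.- q) ≡ (ℚ.- p) ℚ.- (ℚ.- q)
    regroup = solve 2 (λ p q → :- (p :- q) := (:- p) :- (:- q)) refl
      where open +-*-Solver

    flip : ∀ m n → ℚ.∣ x m ℚ.- x n ∣ ≡ ℚ.∣ (ℚ.- x m) ℚ.- (ℚ.- x n) ∣
    flip m n = trans (sym (ℚ.∣-p∣≡∣p∣ (x m ℚ.- x n))) (cong ℚ.∣_∣ (regroup (x m) (x n)))

  divide : ∀ B η → 0ℚ ℚ.< B → 0ℚ ℚ.< η → ∃ λ δ → 0ℚ ℚ.< δ × B ℚ.* δ ≡ η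
  divide B η 0<B 0<η = B⁻¹ ℚ.* η , 0<δ , eq
    where
    instance
      B-pos : ℚ.Positive B
      B-pos = ℚ.positive 0<B
      B-nonZero : ℚ.NonZero B
      B-nonZero = ℚ.pos⇒nonZero B
    B⁻¹ : ℚ
    B⁻¹ = ℚ.1/ B
    0<δ : 0ℚ ℚ.< B⁻¹ ℚ.* η
    0<δ = ℚ.positive⁻¹ (B⁻¹ ℚ.* η)
      {{ℚ.pos*pos⇒pos B⁻¹ {{ℚ.1/pos⇒pos B}} η {{ℚ.positive 0<η}}}}
    eq : B ℚ.* (B⁻¹ ℚ.* η) ≡ η
    eq = trans (sym (ℚ.*-assoc B B⁻¹ η))
           (trans (cong (ℚ._* η) (ℚ.*-inverseʳ B)) (ℚ.*-identityˡ η))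

  ∣p*q∣<η : ∀ {B δ η} p q → 0ℚ ℚ.< B → B ℚ.* δ ≡ η →
            ℚ.∣ p ∣ ℚ.≤ B → ℚ.∣ q ∣ ℚ.< δ → ℚ.∣ p ℚ.* q ∣ ℚ.< η
  ∣p*q∣<η {B} {δ} {η} p q 0<B Bδ≡η ∣p∣≤B ∣q∣<δ = begin-strict
    ℚ.∣ p ℚ.* q ∣          ≡⟨ ℚ.∣p*q∣≡∣p∣*∣q∣ p q ⟩
    ℚ.∣ p ∣ ℚ.* ℚ.∣ q ∣    ≤⟨ ℚ.*-monoʳ-≤-nonNeg ℚ.∣ q ∣ {{ℚ.∣-∣-nonNeg q}} ∣p∣≤B ⟩
    B ℚ.* ℚ.∣ q ∣          <⟨ ℚ.*-monoʳ-<-pos B {{ℚ.positive 0<B}} ∣q∣<δ ⟩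
    B ℚ.* δ                ≡⟨ Bδ≡η ⟩
    η                      ∎
    where open ℚ.≤-Reasoning

  productDifference : ∀ a b c d →
    a ℚ.* b ℚ.- c ℚ.* d ≡ a ℚ.* (b ℚ.- d) ℚ.+ d ℚ.* (a ℚ.- c)
  productDifference a b c d = sym (begin
    a ℚ.* (b ℚ.- d) ℚ.+ d ℚ.* (a ℚ.- c)
      ≡⟨ cong₂ ℚ._+_ (ℚ.*-distribˡ-+ a b (ℚ.- d)) (ℚ.*-distribˡ-+ d a (ℚ.- c)) ⟩
    (a ℚ.* b ℚ.+ a ℚ.* ℚ.- d) ℚ.+ (d ℚ.* a ℚ.+ d ℚ.* ℚ.- c)
      ≡⟨ cong₂ (λ u v → (a ℚ.* b ℚ.+ u) ℚ.+ (d ℚ.* a ℚ.+ v))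
           (trans (sym (ℚ.neg-distribʳ-* a d)) (cong ℚ.-_ (ℚ.*-comm a d)))
           (trans (sym (ℚ.neg-distribʳ-* d c)) (cong ℚ.-_ (ℚ.*-comm d c))) ⟩
    (a ℚ.* b ℚ.- d ℚ.* a) ℚ.+ (d ℚ.* a ℚ.- c ℚ.* d)
      ≡⟨ telescope (a ℚ.* b) (d ℚ.* a) (c ℚ.* d) ⟩
    a ℚ.* b ℚ.- c ℚ.* d ∎)
    where
    open ≡-Reasoning
    telescope : ∀ p q r → (p ℚ.- q) ℚ.+ (q ℚ.- r) ≡ p ℚ.- r
    telescope = solve 3 (λ p q r → (p :- q) :+ (q :- r) := p :- r) refl
      where open +-*-Solver

  *-cauchy : ∀ x y → IsCauchy x → IsCauchy y → IsCauchy (λ n → x n ℚ.* y n)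
  *-cauchy x y cx cy ε 0<ε =
    let B₁ , 0<B₁ , K₁ , bound₁ = bounded x cx
        B₂ , 0<B₂ , K₂ , bound₂ = bounded y cy
        δ₁ , 0<δ₁ , eq₁         = divide B₁ (½ ℚ.* ε) 0<B₁ (halve ε 0<ε)
        δ₂ , 0<δ₂ , eq₂         = divide B₂ (½ ℚ.* ε) 0<B₂ (halve ε 0<ε)
        N₁ , close₁             = cx δ₂ 0<δ₂
        N₂ , close₂             = cy δ₁ 0<δ₁
        K = K₁ ℕ.⊔ K₂
        N = N₁ ℕ.⊔ N₂
    in K ℕ.⊔ N , λ m n ≤m ≤n → combine (x m) (y m) (x n) (y n)
         (∣p*q∣<η (x m) (y m ℚ.- y n) 0<B₁ eq₁
           (bound₁ m (ℕ.m⊔n≤o⇒m≤o K₁ K₂ (ℕ.m⊔n≤o⇒m≤o K N ≤m)))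
           (close₂ m n (ℕ.m⊔n≤o⇒n≤o N₁ N₂ (ℕ.m⊔n≤o⇒n≤o K N ≤m))
                       (ℕ.m⊔n≤o⇒n≤o N₁ N₂ (ℕ.m⊔n≤o⇒n≤o K N ≤n))))
         (∣p*q∣<η (y n) (x m ℚ.- x n) 0<B₂ eq₂
           (bound₂ n (ℕ.m⊔n≤o⇒n≤o K₁ K₂ (ℕ.m⊔n≤o⇒m≤o K N ≤n)))
           (close₁ m n (ℕ.m⊔n≤o⇒m≤o N₁ N₂ (ℕ.m⊔n≤o⇒n≤o K N ≤m))
                       (ℕ.m⊔n≤o⇒m≤o N₁ N₂ (ℕ.m⊔n≤o⇒n≤o K N ≤n))))
    where
    combine : ∀ a b c d →
      ℚ.∣ a ℚ.* (b ℚ.- d) ∣ ℚ.< ½ ℚ.* ε → ℚ.∣ d ℚ.* (a ℚ.- c) ∣ ℚ.< ½ ℚ.* ε →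
      ℚ.∣ a ℚ.* b ℚ.- c ℚ.* d ∣ ℚ.< ε
    combine a b c d p q = begin-strict
      ℚ.∣ a ℚ.* b ℚ.- c ℚ.* d ∣                              ≡⟨ cong ℚ.∣_∣ (productDifference a b c d) ⟩
      ℚ.∣ a ℚ.* (b ℚ.- d) ℚ.+ d ℚ.* (a ℚ.- c) ∣              ≤⟨ ℚ.∣p+q∣≤∣p∣+∣q∣ (a ℚ.* (b ℚ.- d)) (d ℚ.* (a ℚ.- c)) ⟩
      ℚ.∣ a ℚ.* (b ℚ.- d) ∣ ℚ.+ ℚ.∣ d ℚ.* (a ℚ.- c) ∣        <⟨ ℚ.+-mono-< p q ⟩
      ½ ℚ.* ε ℚ.+ ½ ℚ.* ε                                    ≡⟨ halves ε ⟩
      ε                                                      ∎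
      where open ℚ.≤-Reasoning

  ∣∣p∣-∣q∣∣≤∣p-q∣ : ∀ p q → ℚ.∣ ℚ.∣ p ∣ ℚ.- ℚ.∣ q ∣ ∣ ℚ.≤ ℚ.∣ p ℚ.- q ∣
  ∣∣p∣-∣q∣∣≤∣p-q∣ p q with ℚ.∣p∣≡p∨∣p∣≡-p (ℚ.∣ p ∣ ℚ.- ℚ.∣ q ∣)
  ... | inj₁ eq = subst (ℚ._≤ ℚ.∣ p ℚ.- q ∣) (sym eq) (oneSided p q)
    where
    oneSided : ∀ p q → ℚ.∣ p ∣ ℚ.- ℚ.∣ q ∣ ℚ.≤ ℚ.∣ p ℚ.- q ∣
    oneSided p q = begin
      ℚ.∣ p ∣ ℚ.- ℚ.∣ q ∣                            ≡⟨ cong (λ r → ℚ.∣ r ∣ ℚ.- ℚ.∣ q ∣) (split p q) ⟩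
      ℚ.∣ (p ℚ.- q) ℚ.+ q ∣ ℚ.- ℚ.∣ q ∣              ≤⟨ ℚ.+-monoˡ-≤ (ℚ.- ℚ.∣ q ∣) (ℚ.∣p+q∣≤∣p∣+∣q∣ (p ℚ.- q) q) ⟩
      (ℚ.∣ p ℚ.- q ∣ ℚ.+ ℚ.∣ q ∣) ℚ.- ℚ.∣ q ∣        ≡⟨ cancel ℚ.∣ p ℚ.- q ∣ ℚ.∣ q ∣ ⟩
      ℚ.∣ p ℚ.- q ∣                                  ∎
      where
      open ℚ.≤-Reasoning
      open +-*-Solver
      split : ∀ p q → p ≡ (p ℚ.- q) ℚ.+ q
      split = solve 2 (λ p q → p := (p :- q) :+ q) refl
      cancel : ∀ a b → (a ℚ.+ b) ℚ.- b ≡ a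
      cancel = solve 2 (λ a b → (a :+ b) :- b := a) refl
  ... | inj₂ eq = subst (ℚ._≤ ℚ.∣ p ℚ.- q ∣) (sym eq) (begin
      ℚ.- (ℚ.∣ p ∣ ℚ.- ℚ.∣ q ∣)                      ≡⟨ cong (λ r → ℚ.- (ℚ.∣ p ∣ ℚ.- ℚ.∣ r ∣)) (split q p) ⟩
      ℚ.- (ℚ.∣ p ∣ ℚ.- ℚ.∣ p ℚ.- (p ℚ.- q) ∣)        ≡⟨ swap ℚ.∣ p ∣ ℚ.∣ p ℚ.- (p ℚ.- q) ∣ ⟩
      ℚ.∣ p ℚ.- (p ℚ.- q) ∣ ℚ.- ℚ.∣ p ∣              ≤⟨ ℚ.+-monoˡ-≤ (ℚ.- ℚ.∣ p ∣) (ℚ.∣p-q∣≤∣p∣+∣q∣ p (p ℚ.- q)) ⟩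
      (ℚ.∣ p ∣ ℚ.+ ℚ.∣ p ℚ.- q ∣) ℚ.- ℚ.∣ p ∣        ≡⟨ cancel ℚ.∣ p ∣ ℚ.∣ p ℚ.- q ∣ ⟩
      ℚ.∣ p ℚ.- q ∣                                  ∎)
      where
      open ℚ.≤-Reasoning
      open +-*-Solver
      split : ∀ q p → q ≡ p ℚ.- (p ℚ.- q)
      split = solve 2 (λ q p → q := p :- (p :- q)) refl
      swap : ∀ a b → ℚ.- (a ℚ.- b) ≡ b ℚ.- a
      swap = solve 2 (λ a b → :- (a :- b) := b :- a) refl
      cancel : ∀ a b → (a ℚ.+ b) ℚ.- a ≡ b
      cancel = solve 2 (λ a b → (a :+ b) :- a := b) refl

  abs-cauchy : ∀ x → IsCauchy x → IsCauchy (λ n → ℚ.∣ x n ∣)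
  abs-cauchy x cx ε 0<ε with cx ε 0<ε
  ... | N , close = N , λ m n N≤m N≤n →
    ℚ.≤-<-trans (∣∣p∣-∣q∣∣≤∣p-q∣ (x m) (x n)) (close m n N≤m N≤n)

  const-cauchy : ∀ q → IsCauchy (λ _ → q)
  const-cauchy q ε 0<ε = 0 , λ _ _ _ _ →
    subst (ℚ._< ε) (sym (cong ℚ.∣_∣ (ℚ.+-inverseʳ q))) 0<ε

infixl 6 _+_ _-_
infixl 7 _*_
infix  8 -_
infix  4 _≃_ _≤_ _<_

fromℚ : ℚ → ℝ
fromℚ q = mkℝ (λ _ → q) (const-cauchy q)

0ℝ 1ℝ : ℝ
0ℝ = fromℚ 0ℚ
1ℝ = fromℚ 1ℚ

_+_ _*_ : ℝ → ℝ → ℝ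
x + y = mkℝ (λ n → seq x n ℚ.+ seq y n) (+-cauchy (seq x) (seq y) (cauchy x) (cauchy y))
x * y = mkℝ (λ n → seq x n ℚ.* seq y n) (*-cauchy (seq x) (seq y) (cauchy x) (cauchy y))

-_ ∣_∣ : ℝ → ℝ
- x   = mkℝ (λ n → ℚ.- seq x n) (neg-cauchy (seq x) (cauchy x))
∣ x ∣ = mkℝ (λ n → ℚ.∣ seq x n ∣) (abs-cauchy (seq x) (cauchy x))

_-_ : ℝ → ℝ → ℝ
x - y = x + (- y)

_≃_ _≤_ _<_ : ℝ → ℝ → Set
x ≃ y = ∀ (ε : ℚ) → 0ℚ ℚ.< ε →
  ∃ λ N → ∀ n → N ℕ.≤ n → ℚ.∣ seq x n ℚ.- seq y n ∣ ℚ.< ε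
x ≤ y = ∀ (ε : ℚ) → 0ℚ ℚ.< ε →
  ∃ λ N → ∀ n → N ℕ.≤ n → seq x n ℚ.< seq y n ℚ.+ ε
x < y = ∃ λ (ε : ℚ) → 0ℚ ℚ.< ε ×
  ∃ λ N → ∀ n → N ℕ.≤ n → seq x n ℚ.+ ε ℚ.< seq y n

ℝ-rawRing : RawRing 0ℓ 0ℓ
ℝ-rawRing = record
  { Carrier = ℝ
  ; _≈_     = _≃_
  ; _+_     = _+_
  ; _*_     = _*_
  ; -_      = -_
  ; 0#      = 0ℝ
  ; 1#      = 1ℝ
  }

-- f(x + h) = f(x) + d·h + o(h) as h → 0.
HasDerivativeAt : (ℝ → ℝ) → ℝ → ℝ → Set
HasDerivativeAt f x d = ∀ (ε : ℝ) → 0ℝ < ε →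
  ∃ λ (δ : ℝ) → 0ℝ < δ × (∀ h → ∣ h ∣ < δ →
    ∣ (f (x + h) - f x) - d * h ∣ ≤ ε * ∣ h ∣)

IsMaximum : (ℝ → Set) → ℝ → Set
IsMaximum S M = S M × (∀ v → S v → v ≤ M)

------------------------------------------------------------------------
-- Determinants and circulant matrices

SquareMatrix : ∀ {a} → Set a → ℕ → Set a
SquareMatrix A n = Fin n → Fin n → A

-- Laplace expansion along the first row.
module Determinant {c ℓ} (R : RawRing c ℓ) where
  open RawRing R using (Carrier; 1#; rawSemiring)
    renaming (_*_ to _·_; -_ to neg_)
  open RawSemiringDefs rawSemiring using (_^_; sum)

  det : ∀ {n} → SquareMatrix Carrier n → Carrier
  det {zero}  M = 1#
  det {suc n} M = sum λ j →
    ((neg 1#) ^ toℕ j) · M zero j · det (λ i k → M (suc i) (punchIn j k))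

open Determinant ℝ-rawRing public using (det)

-- Adding n before the truncated subtraction makes the argument of _mod_
-- the natural number n + k - j, which is congruent to k - j modulo n.
circ : ∀ {A : Set} {n} .{{_ : NonZero n}} → Vector A n → SquareMatrix A n
circ {n = n} a j k = a (((n ℕ.+ toℕ k) ℕ.∸ toℕ j) mod n)

Cube Vertex : ∀ {n} → Vector ℝ n → Set
Cube   a = ∀ i → 0ℝ ≤ a i × a i ≤ 1ℝ
Vertex a = ∀ i → a i ≃ 0ℝ ⊎ a i ≃ 1ℝ

AbsDets : ∀ {n} .{{_ : NonZero n}} → (Vector ℝ n → Set) → ℝ → Set
AbsDets P v = ∃ λ a → P a × ∣ det (circ a) ∣ ≃ v

IsD₀₁ : ∀ n .{{_ : NonZero n}} → ℝ → Set
IsD₀₁ n = IsMaximum (AbsDets {n} Vertex)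

-- The maximum of |det circ(a)| over a ∈ [0,1]ⁿ exceeds D and is attained at
-- no extreme point.  A continuous function on the cube attains its supremum
-- only classically, so the last component, and it alone, is conditional on
-- excluded middle; the first is its constructive core.
CubeMaximumExceeds : ∀ n .{{_ : NonZero n}} → ℝ → Set₁
CubeMaximumExceeds n D =
    (∃ λ (a : Vector ℝ n) → Cube a × D < ∣ det (circ a) ∣)
  × (∀ (a : Vector ℝ n) → Vertex a → ¬ IsMaximum (AbsDets {n} Cube) ∣ det (circ a) ∣)
  × (ExcludedMiddle 0ℓ → ∃ λ M → IsMaximum (AbsDets {n} Cube) M × D < M)

{-# OPTIONS --safe #-}

-- The Laplace expansion is evaluated as the top coefficient of the exterior
-- product of the rows, which visits each minor of the last k rows only once; so
-- the determinants of all 0-1 circulants of order 9 and 10, and the polynomial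
-- det A(x), are found by computation.  Since det is Lipschitz on the cube, they
-- determine it at real vertices, which are Cauchy sequences converging to 0-1
-- vectors.
--
-- For the maximum over the cube, call a set of rational points dominating if f
-- takes in it values at least as large as at any point of the cube.  When a
-- dominating set is cut in two, one of the parts is dominating by excluded
-- middle; halving the cube repeatedly converges to a maximizer.

module Submission where

open import Defs
open import Level using (0ℓ)
open import Algebra.Bundles.Raw using (RawRing)
import Algebra.Definitions.RawSemiring as RawSemiringDefs
open import Axiom.ExcludedMiddle using (ExcludedMiddle)
open import Data.Bool.Base using (Bool; true; false; _∧_; T; if_then_else_)
open import Data.Bool.Properties using (T-∧)
open import Data.Fin.Base using (Fin; zero; suc; toℕ; punchIn)
open import Data.Integer.Base as ℤ using (ℤ; +_; +[1+_]; -[1+_]; 0ℤ; 1ℤ)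
import Data.Integer.Properties as ℤ
open import Data.List.Base as List using (List) renaming ([] to []ˡ; _∷_ to _∷ˡ_)
import Data.List.Properties as List
open import Data.Nat.Base as ℕ using (ℕ; zero; suc; NonZero)
open import Data.Nat.DivMod using (_mod_)
import Data.Nat.Properties as ℕ
open import Data.Product.Base using (∃; _×_; _,_; proj₁; proj₂)
open import Data.Rational.Base as ℚ using (ℚ; 0ℚ; 1ℚ; ½; mkℚ; ↧ₙ_; _/_)
import Data.Rational.Properties as ℚ
open import Data.Rational.Solver using (module +-*-Solver)
open import Data.Rational.Unnormalised.Base as ℚᵘ using (mkℚᵘ; *≡*; *≤*)
import Data.Rational.Unnormalised.Properties as ℚᵘ
open import Data.Sum.Base using (_⊎_; inj₁; inj₂)
open import Data.Vec.Base using (Vec; lookup; tabulate) renaming ([] to []ᵛ; _∷_ to _∷ᵛ_)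
open import Data.Vec.Functional using (Vector; _∷_; [])
open import Data.Vec.Properties using (lookup∘tabulate)
open import Function.Bundles using (Equivalence)
open import Relation.Binary.PropositionalEquality
open import Relation.Nullary using (¬_; Dec; yes; no; does; contradiction)
open import Relation.Nullary.Decidable using (from-yes)

-- Parametricity of the determinant

-- The reals enter only as a raw ring of Cauchy sequences whose operations act termwise. No ring law
-- of ℝ is ever proved: the `m`-th term of a real determinant is the rational determinant of the
-- `m`-th terms, so each claim is reduced to one about rational matrices that holds for all large
-- `m`. Since the same Laplace recursion is read over ℝ, over ℚ and over a ring of functions, one
-- relational induction on it serves all the transfers. The order on ℝ is undecidable, which rules
-- out comparing real values of the determinant during a bisection, and no supremum is formed.
-- Domination compares rational values at rational points, where the order is total and decidable;
-- excluded middle is spent only on whether a rational point with a given property exists.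
-- Continuity enters once, at the end, to pass from dominating rational points in small boxes to the
-- limit of the boxes.

module _ {a r b s} (R : RawRing a r) (S : RawRing b s) where
  private
    module R = RawRing R
    module S = RawRing S
  open RawSemiringDefs R.rawSemiring using () renaming (sum to sumᴿ; _^_ to _^ᴿ_)
  open RawSemiringDefs S.rawSemiring using () renaming (sum to sumˢ; _^_ to _^ˢ_)
  open Determinant R using () renaming (det to detᴿ)
  open Determinant S using () renaming (det to detˢ)

  module _ {ℓ} (_~_ : R.Carrier → S.Carrier → Set ℓ)
    (+-~ : ∀ {x y u v} → x ~ u → y ~ v → (x R.+ y) ~ (u S.+ v))
    (*-~ : ∀ {x y u v} → x ~ u → y ~ v → (x R.* y) ~ (u S.* v))
    (neg-~ : ∀ {x u} → x ~ u → (R.- x) ~ (S.- u))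
    (0-~ : R.0# ~ S.0#)
    (1-~ : R.1# ~ S.1#)
    where

    sum-related : ∀ {n} {f : Fin n → R.Carrier} {g : Fin n → S.Carrier} →
                  (∀ i → f i ~ g i) → sumᴿ f ~ sumˢ g
    sum-related {zero}  f~g = 0-~
    sum-related {suc n} f~g = +-~ (f~g zero) (sum-related (λ i → f~g (suc i)))

    ^-related : ∀ {x u} k → x ~ u → (x ^ᴿ k) ~ (u ^ˢ k)
    ^-related zero    x~u = 1-~
    ^-related (suc k) x~u = *-~ x~u (^-related k x~u)

    -- The relation is arbitrary, and each choice gives a different fact: equality gives congruence
    -- without function extensionality, "has `m`-th term" and "has value at `x`" give homomorphisms,
    -- and a relation that ignores its second argument gives closure of a predicate under `det`.
    det-related : ∀ {n} {M : SquareMatrix R.Carrier n} {N : SquareMatrix S.Carrier n} →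
                  (∀ i j → M i j ~ N i j) → detᴿ M ~ detˢ N
    det-related {zero}  M~N = 1-~
    det-related {suc n} M~N = sum-related λ j →
      *-~ (*-~ (^-related (toℕ j) (neg-~ 1-~)) (M~N zero j))
          (det-related (λ i k → M~N (suc i) (punchIn j k)))

open Determinant ℚ.+-*-rawRing using () renaming (det to detℚ)
open RawSemiringDefs (RawRing.rawSemiring ℚ.+-*-rawRing) using () renaming (sum to sumℚ; _^_ to _^ℚ_)

sumℚ-cong : ∀ {n} {f g : Fin n → ℚ} → (∀ i → f i ≡ g i) → sumℚ f ≡ sumℚ g
sumℚ-cong = sum-related ℚ.+-*-rawRing ℚ.+-*-rawRing _≡_
  (cong₂ ℚ._+_) (cong₂ ℚ._*_) (cong λ p → ℚ.- p) refl refl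

detℚ-cong : ∀ {n} {M N : SquareMatrix ℚ n} → (∀ i j → M i j ≡ N i j) → detℚ M ≡ detℚ N
detℚ-cong = det-related ℚ.+-*-rawRing ℚ.+-*-rawRing _≡_
  (cong₂ ℚ._+_) (cong₂ ℚ._*_) (cong λ p → ℚ.- p) refl refl

*-distribˡ-sumℚ : ∀ {n} c (f : Fin n → ℚ) → sumℚ (λ i → c ℚ.* f i) ≡ c ℚ.* sumℚ f
*-distribˡ-sumℚ {zero}  c f = sym (ℚ.*-zeroʳ c)
*-distribˡ-sumℚ {suc n} c f = begin
  c ℚ.* f zero ℚ.+ sumℚ (λ i → c ℚ.* f (suc i))   ≡⟨ cong (c ℚ.* f zero ℚ.+_) (*-distribˡ-sumℚ c (λ i → f (suc i))) ⟩
  c ℚ.* f zero ℚ.+ c ℚ.* sumℚ (λ i → f (suc i))   ≡⟨ ℚ.*-distribˡ-+ c (f zero) _ ⟨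
  c ℚ.* (f zero ℚ.+ sumℚ (λ i → f (suc i)))       ∎
  where open ≡-Reasoning

-- Exterior powers of a free module

-- There is no `skip` at size 0, so every subset has exactly one code. A form of degree 0 can then
-- be a single scalar whatever `n` is.
data Subset : ℕ → ℕ → Set where
  none : ∀ {n} → Subset n 0
  take : ∀ {n k} → Subset n k → Subset (suc n) (suc k)
  skip : ∀ {n k} → Subset n (suc k) → Subset (suc n) (suc k)

skip′ : ∀ {n k} → Subset n k → Subset (suc n) k
skip′ none     = none
skip′ (take s) = skip (take s)
skip′ (skip s) = skip (skip s)

full : ∀ n → Subset n n
full zero    = none
full (suc n) = take (full n)

enum : ∀ {n k} → Subset n k → Fin k → Fin n
enum (take s) zero    = zero
enum (take s) (suc j) = suc (enum s j)
enum (skip s) j       = suc (enum s j)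

remove : ∀ {n k} → Subset n (suc k) → Fin (suc k) → Subset n k
remove         (take s) zero    = skip′ s
remove {k = suc _} (take s) (suc j) = take (remove s j)
remove         (skip s) j       = skip′ (remove s j)

enum-skip′ : ∀ {n k} (s : Subset n k) i → enum (skip′ s) i ≡ suc (enum s i)
enum-skip′ (take s) i = refl
enum-skip′ (skip s) i = refl

-- Matches the smaller subsets that index coefficients with the minors of the Laplace expansion,
-- whose columns are chosen by `punchIn`.
enum-remove : ∀ {n k} (s : Subset n (suc k)) j i →
              enum (remove s j) i ≡ enum s (punchIn j i)
enum-remove (take s) zero    i       = enum-skip′ s i
enum-remove {k = suc _} (take s) (suc j) zero    = refl
enum-remove {k = suc _} (take s) (suc j) (suc i) = cong suc (enum-remove s j i)
enum-remove (skip s) j       i       = trans (enum-skip′ (remove s j) i) (cong suc (enum-remove s j i))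

enum-full : ∀ n i → enum (full n) i ≡ i
enum-full (suc n) zero    = refl
enum-full (suc n) (suc i) = cong suc (enum-full n i)

-- An element of the k-th exterior power of Aⁿ: one coefficient for each
-- k-element subset of the basis.  A node is e₀ ∧ y + z.
data Form (A : Set) : ℕ → ℕ → Set where
  leaf  : ∀ {n} → A → Form A n 0
  empty : ∀ {k} → Form A 0 (suc k)
  node  : ∀ {n k} (y : Form A n k) (z : Form A n (suc k)) → Form A (suc n) (suc k)

coeff : ∀ {A n k} → Form A n k → Subset n k → A
coeff (leaf a)   none     = a
coeff (node y z) (take s) = coeff y s
coeff (node y z) (skip s) = coeff z s

zipForm : ∀ {A n k} → (A → A → A) → Form A n k → Form A n k → Form A n k
zipForm f (leaf a)   (leaf b)     = leaf (f a b)
zipForm f empty      empty        = empty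
zipForm f (node y z) (node y′ z′) = node (zipForm f y y′) (zipForm f z z′)

coeff-zipForm : ∀ {A n k} f (t u : Form A n k) s → coeff (zipForm f t u) s ≡ f (coeff t s) (coeff u s)
coeff-zipForm f (leaf a)   (leaf b)     none     = refl
coeff-zipForm f (node y z) (node y′ z′) (take s) = coeff-zipForm f y y′ s
coeff-zipForm f (node y z) (node y′ z′) (skip s) = coeff-zipForm f z z′ s

-- For f e a b = b + e a and g e a b = b − e a this is e ↦ (e ∧_); moving the
-- head of the vector past e₀ flips the sign, that is, swaps f and g.
wedge : ∀ {E A : Set} {n k} → A → (f g : E → A → A → A) →
        Vec E n → Form A n k → Form A n (suc k)
wedge 0# f g []ᵛ       t          = empty
wedge 0# f g (e ∷ᵛ es) (leaf a)   = node (leaf (f e a 0#)) (wedge 0# f g es (leaf a))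
wedge 0# f g (e ∷ᵛ es) (node y z) =
  node (zipForm (f e) z (wedge 0# g f es y)) (wedge 0# f g es z)

wedgeRows : ∀ {E A : Set} {n} → A → A → (f g : E → A → A → A) →
            ∀ k → (Fin k → Vec E n) → Form A n k
wedgeRows 0# 1# f g zero    M = leaf 1#
wedgeRows 0# 1# f g (suc k) M = wedge 0# f g (M zero) (wedgeRows 0# 1# f g k (λ i → M (suc i)))

fastDet : ∀ {E A : Set} → A → A → (f g : E → A → A → A) → ∀ n → (Fin n → Vec E n) → A
fastDet 0# 1# f g n M = coeff (wedgeRows 0# 1# f g n M) (full n)

-- Correctness of the exterior product

module _ {E A : Set} (_∼_ : E → ℚ → Set) (_≈_ : A → ℚ → Set)
         {0# 1# : A} (0-≈ : 0# ≈ 0ℚ) (1-≈ : 1# ≈ 1ℚ) where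

  -- The only law asked of the coefficients `A`. All algebraic identities are proved in ℚ, so
  -- integers and coefficient lists need no ring laws, and an entry 0 may skip the arithmetic
  -- altogether.
  MulAdd : ℚ → (E → A → A → A) → Set
  MulAdd σ f = ∀ e a b {q u v} → e ∼ q → a ≈ u → b ≈ v → f e a b ≈ (v ℚ.+ σ ℚ.* (q ℚ.* u))

  private
    laplaceTerm : ∀ {n k} → (Fin n → ℚ) → (Subset n k → ℚ) → Subset n (suc k) → Fin (suc k) → ℚ
    laplaceTerm ρ φ s j = ((ℚ.- 1ℚ) ^ℚ toℕ j) ℚ.* ρ (enum s j) ℚ.* φ (remove s j)

    regroup : ∀ σ q u w → (ℚ.- σ) ℚ.* w ℚ.+ σ ℚ.* (q ℚ.* u) ≡
                          σ ℚ.* (1ℚ ℚ.* q ℚ.* u ℚ.+ (ℚ.- 1ℚ) ℚ.* w)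
    regroup = solve 4 (λ σ q u w → (:- σ) :* w :+ σ :* (q :* u) :=
                          σ :* (con 1ℚ :* q :* u :+ con (ℚ.- 1ℚ) :* w)) refl
      where open +-*-Solver

    shiftSign : ∀ s r p → (ℚ.- 1ℚ) ℚ.* s ℚ.* r ℚ.* p ≡ (ℚ.- 1ℚ) ℚ.* (s ℚ.* r ℚ.* p)
    shiftSign = solve 3 (λ s r p → con (ℚ.- 1ℚ) :* s :* r :* p := con (ℚ.- 1ℚ) :* (s :* r :* p)) refl
      where open +-*-Solver

    leafSum : ∀ σ q u → 0ℚ ℚ.+ σ ℚ.* (q ℚ.* u) ≡ σ ℚ.* (1ℚ ℚ.* q ℚ.* u ℚ.+ 0ℚ)
    leafSum = solve 3 (λ σ q u → con 0ℚ :+ σ :* (q :* u) := σ :* (con 1ℚ :* q :* u :+ con 0ℚ)) refl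
      where open +-*-Solver

  -- Wedging with a row is a Laplace expansion along it, with `φ` as the minors. At `take s` two
  -- contributions meet: the head of the row times the coefficient of `z`, which is the term
  -- `j = 0`, and the rest of the row wedged with `y`, which gives the terms `j > 0` with the
  -- opposite sign.
  coeff-wedge : ∀ {n k} σ {f g} → MulAdd σ f → MulAdd (ℚ.- σ) g →
    (es : Vec E n) (ρ : Fin n → ℚ) → (∀ i → lookup es i ∼ ρ i) →
    (t : Form A n k) (φ : Subset n k → ℚ) → (∀ s → coeff t s ≈ φ s) →
    ∀ s → coeff (wedge 0# f g es t) s ≈ (σ ℚ.* sumℚ (laplaceTerm ρ φ s))
  coeff-wedge σ F G (e ∷ᵛ es) ρ es∼ρ (leaf a) φ t≈φ (take none) =
    subst (_ ≈_) (leafSum σ (ρ zero) (φ none)) (F e a 0# (es∼ρ zero) (t≈φ none) 0-≈)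
  coeff-wedge σ F G (e ∷ᵛ es) ρ es∼ρ (leaf a) φ t≈φ (skip s) =
    subst (_ ≈_) (cong (σ ℚ.*_) (sumℚ-cong λ j → cong (((ℚ.- 1ℚ) ^ℚ toℕ j ℚ.* ρ (suc (enum s j))) ℚ.*_) (cong φ (unique (remove s j)))))
      (coeff-wedge σ F G es (λ i → ρ (suc i)) (λ i → es∼ρ (suc i)) (leaf a) (λ _ → φ none)
        (λ { none → t≈φ none }) s)
    where
    unique : ∀ {n} (s : Subset n 0) → none ≡ skip′ s
    unique none = refl
  coeff-wedge σ {f} {g} F G (e ∷ᵛ es) ρ es∼ρ (node y z) φ t≈φ (take s) =
    subst₂ _≈_ (sym (coeff-zipForm (f e) z (wedge 0# g f es y) s)) eq
      (F e _ _ (es∼ρ zero) (z≈ s) rest)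
    where
    z≈ : ∀ s → coeff z s ≈ φ (skip′ s)
    z≈ s@(take _) = t≈φ (skip s)
    z≈ s@(skip _) = t≈φ (skip s)
    ρ′ : Fin _ → ℚ
    ρ′ i = ρ (suc i)
    φ′ : Subset _ _ → ℚ
    φ′ s = φ (take s)
    rest : coeff (wedge 0# g f es y) s ≈ ((ℚ.- σ) ℚ.* sumℚ (laplaceTerm ρ′ φ′ s))
    -- Passing the rest of the row across e₀ changes the sign, so the recursion runs at `- σ`; its
    -- second operation is `f`, which must then have sign `- (- σ)`.
    rest = coeff-wedge (ℚ.- σ) G
      (subst (λ τ → MulAdd τ f) (sym (ℚ-neg-involutive σ)) F)
      es ρ′ (λ i → es∼ρ (suc i)) y φ′ (λ s → t≈φ (take s)) s
      where
      ℚ-neg-involutive : ∀ p → ℚ.- (ℚ.- p) ≡ p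
      ℚ-neg-involutive = solve 1 (λ p → :- (:- p) := p) refl
        where open +-*-Solver
    eq : (ℚ.- σ) ℚ.* sumℚ (laplaceTerm ρ′ φ′ s) ℚ.+ σ ℚ.* (ρ zero ℚ.* φ (skip′ s)) ≡
         σ ℚ.* sumℚ (laplaceTerm ρ φ (take s))
    eq = trans (regroup σ (ρ zero) (φ (skip′ s)) (sumℚ (laplaceTerm ρ′ φ′ s)))
      (cong (λ w → σ ℚ.* (1ℚ ℚ.* ρ zero ℚ.* φ (skip′ s) ℚ.+ w))
        (trans (sym (*-distribˡ-sumℚ (ℚ.- 1ℚ) (laplaceTerm ρ′ φ′ s)))
          (sumℚ-cong λ j → sym (shiftSign ((ℚ.- 1ℚ) ^ℚ toℕ j) (ρ′ (enum s j)) (φ′ (remove s j))))))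
  coeff-wedge σ F G (e ∷ᵛ es) ρ es∼ρ (node y z) φ t≈φ (skip s) =
    coeff-wedge σ F G es (λ i → ρ (suc i)) (λ i → es∼ρ (suc i)) z (λ s → φ (skip′ s)) z≈ s
    where
    z≈ : ∀ s → coeff z s ≈ φ (skip′ s)
    z≈ s@(take _) = t≈φ (skip s)
    z≈ s@(skip _) = t≈φ (skip s)

  module _ {f g : E → A → A → A} (F : MulAdd 1ℚ f) (G : MulAdd (ℚ.- 1ℚ) g) where

    -- By induction the product of the remaining rows has the minors of those rows as coefficients;
    -- one more row expands along itself by `coeff-wedge`, and `enum-remove` puts the columns into
    -- the form used by `det`.
    coeff-wedgeRows : ∀ {n} k (M : Fin k → Vec E n) (N : Fin k → Fin n → ℚ) →
      (∀ i j → lookup (M i) j ∼ N i j) →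
      ∀ s → coeff (wedgeRows 0# 1# f g k M) s ≈ detℚ (λ i j → N i (enum s j))
    coeff-wedgeRows zero    M N M∼N none = 1-≈
    coeff-wedgeRows (suc k) M N M∼N s =
      subst (coeff (wedgeRows 0# 1# f g (suc k) M) s ≈_)
        (trans (ℚ.*-identityˡ _) (sumℚ-cong λ j →
          cong (((ℚ.- 1ℚ) ^ℚ toℕ j ℚ.* N zero (enum s j)) ℚ.*_) (detℚ-cong λ i l → cong (N (suc i)) (enum-remove s j l))))
        (coeff-wedge 1ℚ F G (M zero) (N zero) (M∼N zero)
          (wedgeRows 0# 1# f g k (λ i → M (suc i)))
          (λ s → detℚ (λ i j → N (suc i) (enum s j)))
          (coeff-wedgeRows k (λ i → M (suc i)) (λ i → N (suc i)) (λ i → M∼N (suc i))) s)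

    fastDet-correct : ∀ n (M : Fin n → Vec E n) (N : SquareMatrix ℚ n) →
      (∀ i j → lookup (M i) j ∼ N i j) → fastDet 0# 1# f g n M ≈ detℚ N
    fastDet-correct n M N M∼N =
      subst (_ ≈_) (detℚ-cong λ i j → cong (N i) (enum-full n j))
        (coeff-wedgeRows n M N M∼N (full n))

-- Integers as rationals

fromℤ : ℤ → ℚ
fromℤ z = z ℚ./ 1

private
  toℚᵘ-fromℤ : ∀ z → ℚ.toℚᵘ (fromℤ z) ℚᵘ.≃ mkℚᵘ z 0
  toℚᵘ-fromℤ z = ℚ.toℚᵘ-fromℚᵘ (mkℚᵘ z 0)

-- Normalisation divides by a gcd, which is stuck on a variable numerator. Among unnormalised
-- rationals the claim is an identity of integers.
fromℤ-homo-+ : ∀ a b → fromℤ (a ℤ.+ b) ≡ fromℤ a ℚ.+ fromℤ b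
fromℤ-homo-+ a b = ℚ.toℚᵘ-injective (begin
  ℚ.toℚᵘ (fromℤ (a ℤ.+ b))                    ≈⟨ toℚᵘ-fromℤ (a ℤ.+ b) ⟩
  mkℚᵘ (a ℤ.+ b) 0                            ≈⟨ *≡* (cong (ℤ._* 1ℤ) (cong₂ ℤ._+_ (ℤ.*-identityʳ a) (ℤ.*-identityʳ b))) ⟨
  mkℚᵘ a 0 ℚᵘ.+ mkℚᵘ b 0                      ≈⟨ ℚᵘ.+-cong (toℚᵘ-fromℤ a) (toℚᵘ-fromℤ b) ⟨
  ℚ.toℚᵘ (fromℤ a) ℚᵘ.+ ℚ.toℚᵘ (fromℤ b)      ≈⟨ ℚ.toℚᵘ-homo-+ (fromℤ a) (fromℤ b) ⟨
  ℚ.toℚᵘ (fromℤ a ℚ.+ fromℤ b)                ∎)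
  where open ℚᵘ.≃-Reasoning

fromℤ-homo-neg : ∀ a → fromℤ (ℤ.- a) ≡ ℚ.- fromℤ a
fromℤ-homo-neg a = ℚ.toℚᵘ-injective (begin
  ℚ.toℚᵘ (fromℤ (ℤ.- a))      ≈⟨ toℚᵘ-fromℤ (ℤ.- a) ⟩
  ℚᵘ.- mkℚᵘ a 0               ≈⟨ ℚᵘ.-‿cong (toℚᵘ-fromℤ a) ⟨
  ℚᵘ.- ℚ.toℚᵘ (fromℤ a)       ≈⟨ ℚ.toℚᵘ-homo‿- (fromℤ a) ⟨
  ℚ.toℚᵘ (ℚ.- fromℤ a)        ∎)
  where open ℚᵘ.≃-Reasoning

∣fromℤ∣≤ : ∀ z k → ℤ.∣ z ∣ ℕ.≤ k → ℚ.∣ fromℤ z ∣ ℚ.≤ fromℤ (+ k)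
∣fromℤ∣≤ z k le = ℚ.toℚᵘ-cancel-≤ (begin
  ℚ.toℚᵘ ℚ.∣ fromℤ z ∣        ≃⟨ ℚ.toℚᵘ-homo-∣-∣ (fromℤ z) ⟩
  ℚᵘ.∣ ℚ.toℚᵘ (fromℤ z) ∣     ≃⟨ ℚᵘ.∣-∣-cong (toℚᵘ-fromℤ z) ⟩
  mkℚᵘ (+ ℤ.∣ z ∣) 0          ≤⟨ *≤* (ℤ.*-monoʳ-≤-nonNeg 1ℤ (ℤ.+≤+ le)) ⟩
  mkℚᵘ (+ k) 0                ≃⟨ toℚᵘ-fromℤ (+ k) ⟨
  ℚ.toℚᵘ (fromℤ (+ k))        ∎)
  where open ℚᵘ.≤-Reasoning

private
  plusZero : ∀ σ u v → v ≡ v ℚ.+ σ ℚ.* (0ℚ ℚ.* u)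
  plusZero = solve 3 (λ σ u v → v := v :+ σ :* (con 0ℚ :* u)) refl
    where open +-*-Solver

  plusOne : ∀ u v → v ℚ.+ u ≡ v ℚ.+ 1ℚ ℚ.* (1ℚ ℚ.* u)
  plusOne = solve 2 (λ u v → v :+ u := v :+ con 1ℚ :* (con 1ℚ :* u)) refl
    where open +-*-Solver

  minusOne : ∀ u v → v ℚ.+ ℚ.- u ≡ v ℚ.+ (ℚ.- 1ℚ) ℚ.* (1ℚ ℚ.* u)
  minusOne = solve 2 (λ u v → v :+ :- u := v :+ con (ℚ.- 1ℚ) :* (con 1ℚ :* u)) refl
    where open +-*-Solver

-- Determinants of 0-1 circulant matrices

bit : Bool → ℚ
bit false = 0ℚ
bit true  = 1ℚ

addIf subIf : Bool → ℤ → ℤ → ℤ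
addIf false a b = b
addIf true  a b = b ℤ.+ a
subIf false a b = b
subIf true  a b = b ℤ.- a

circDetℤ : ∀ {n} .{{_ : NonZero n}} → Vec Bool n → ℤ
circDetℤ {n} v = fastDet 0ℤ 1ℤ addIf subIf n (λ i → tabulate (circ (lookup v) i))

private
  _≈ℤ_ : ℤ → ℚ → Set
  z ≈ℤ q = fromℤ z ≡ q

  _∼bit_ : Bool → ℚ → Set
  b ∼bit q = bit b ≡ q

  addIf-≈ : MulAdd _∼bit_ _≈ℤ_ {0ℤ} {1ℤ} refl refl 1ℚ addIf
  addIf-≈ false _ _ {u = u} {v} refl _ b = trans b (plusZero 1ℚ u v)
  addIf-≈ true a b refl refl refl =
    trans (fromℤ-homo-+ b a) (plusOne (fromℤ a) (fromℤ b))

  subIf-≈ : MulAdd _∼bit_ _≈ℤ_ {0ℤ} {1ℤ} refl refl (ℚ.- 1ℚ) subIf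
  subIf-≈ false _ _ {u = u} {v} refl _ b = trans b (plusZero (ℚ.- 1ℚ) u v)
  subIf-≈ true a b refl refl refl =
    trans (fromℤ-homo-+ b (ℤ.- a))
      (trans (cong (fromℤ b ℚ.+_) (fromℤ-homo-neg a)) (minusOne (fromℤ a) (fromℤ b)))

circDetℤ-correct : ∀ {n} .{{_ : NonZero n}} (v : Vec Bool n) →
  fromℤ (circDetℤ v) ≡ detℚ (circ (λ i → bit (lookup v i)))
circDetℤ-correct {n} v = fastDet-correct _∼bit_ _≈ℤ_ refl refl addIf-≈ subIf-≈ n _ _
  (λ i j → cong bit (lookup∘tabulate (circ (lookup v) i) j))

-- Boolean-valued, so that running through all 2ⁿ vectors is pure evaluation; `every-sound` recovers
-- the individual bounds afterwards.
every : ∀ n → (Vec Bool n → Bool) → Bool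
every zero    P = P []ᵛ
every (suc n) P = every n (λ v → P (true ∷ᵛ v)) ∧ every n (λ v → P (false ∷ᵛ v))

every-sound : ∀ n P → T (every n P) → ∀ v → T (P v)
every-sound zero    P t []ᵛ = t
every-sound (suc n) P t (true ∷ᵛ v)  =
  every-sound n (λ v → P (true ∷ᵛ v)) (proj₁ (Equivalence.to T-∧ t)) v
every-sound (suc n) P t (false ∷ᵛ v) =
  every-sound n (λ v → P (false ∷ᵛ v))
    (proj₂ (Equivalence.to (T-∧ {every n (λ v → P (true ∷ᵛ v))}) t)) v

boundedBy : ∀ {n} .{{_ : NonZero n}} → ℕ → Vec Bool n → Bool
boundedBy d v = ℤ.∣ circDetℤ v ∣ ℕ.≤ᵇ d

∣det∣≤ : ∀ {n} .{{_ : NonZero n}} d → every n (boundedBy d) ≡ true →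
  ∀ (v : Vec Bool n) → ℚ.∣ detℚ (circ (λ i → bit (lookup v i))) ∣ ℚ.≤ fromℤ (+ d)
∣det∣≤ d t v = subst (λ q → ℚ.∣ q ∣ ℚ.≤ fromℤ (+ d)) (circDetℤ-correct v)
  (∣fromℤ∣≤ (circDetℤ v) d (ℕ.≤ᵇ⇒≤ _ _ (every-sound _ (boundedBy d) (subst T (sym t) _) v)))

-- Circulant matrices with entries 0, 1 and a variable

Poly : Set
Poly = List ℤ

eval : Poly → ℚ → ℚ
eval []ˡ      x = 0ℚ
eval (c ∷ˡ p) x = fromℤ c ℚ.+ x ℚ.* eval p x

_⊞_ _⊟_ : Poly → Poly → Poly
[]ˡ      ⊞ q       = q
(c ∷ˡ p) ⊞ []ˡ      = c ∷ˡ p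
(c ∷ˡ p) ⊞ (d ∷ˡ q) = c ℤ.+ d ∷ˡ p ⊞ q
p ⊟ q = p ⊞ List.map (λ z → ℤ.- z) q

eval-⊞ : ∀ p q x → eval (p ⊞ q) x ≡ eval p x ℚ.+ eval q x
eval-⊞ []ˡ      q       x = sym (ℚ.+-identityˡ _)
eval-⊞ (c ∷ˡ p) []ˡ      x = sym (ℚ.+-identityʳ _)
eval-⊞ (c ∷ˡ p) (d ∷ˡ q) x = begin
  fromℤ (c ℤ.+ d) ℚ.+ x ℚ.* eval (p ⊞ q) x                              ≡⟨ cong₂ (λ u v → u ℚ.+ x ℚ.* v) (fromℤ-homo-+ c d) (eval-⊞ p q x) ⟩
  (fromℤ c ℚ.+ fromℤ d) ℚ.+ x ℚ.* (eval p x ℚ.+ eval q x)               ≡⟨ regroup (fromℤ c) (fromℤ d) x (eval p x) (eval q x) ⟩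
  (fromℤ c ℚ.+ x ℚ.* eval p x) ℚ.+ (fromℤ d ℚ.+ x ℚ.* eval q x)         ∎
  where
  open ≡-Reasoning
  regroup : ∀ c d x p q → (c ℚ.+ d) ℚ.+ x ℚ.* (p ℚ.+ q) ≡ (c ℚ.+ x ℚ.* p) ℚ.+ (d ℚ.+ x ℚ.* q)
  regroup = solve 5 (λ c d x p q → (c :+ d) :+ x :* (p :+ q) := (c :+ x :* p) :+ (d :+ x :* q)) refl
    where open +-*-Solver

eval-map-neg : ∀ p x → eval (List.map (λ z → ℤ.- z) p) x ≡ ℚ.- eval p x
eval-map-neg []ˡ      x = refl
eval-map-neg (c ∷ˡ p) x = begin
  fromℤ (ℤ.- c) ℚ.+ x ℚ.* eval (List.map (λ z → ℤ.- z) p) x    ≡⟨ cong₂ (λ u v → u ℚ.+ x ℚ.* v) (fromℤ-homo-neg c) (eval-map-neg p x) ⟩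
  (ℚ.- fromℤ c) ℚ.+ x ℚ.* (ℚ.- eval p x)                       ≡⟨ regroup (fromℤ c) x (eval p x) ⟩
  ℚ.- (fromℤ c ℚ.+ x ℚ.* eval p x)                             ∎
  where
  open ≡-Reasoning
  regroup : ∀ c x p → (ℚ.- c) ℚ.+ x ℚ.* (ℚ.- p) ≡ ℚ.- (c ℚ.+ x ℚ.* p)
  regroup = solve 3 (λ c x p → (:- c) :+ x :* (:- p) := :- (c :+ x :* p)) refl
    where open +-*-Solver

eval-⊟ : ∀ p q x → eval (p ⊟ q) x ≡ eval p x ℚ.+ ℚ.- eval q x
eval-⊟ p q x = trans (eval-⊞ p _ x) (cong (eval p x ℚ.+_) (eval-map-neg q x))

data Entry : Set where
  O I X : Entry

value : Entry → ℚ → ℚ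
value O x = 0ℚ
value I x = 1ℚ
value X x = x

addMul subMul : Entry → Poly → Poly → Poly
addMul O p q = q
addMul I p q = q ⊞ p
addMul X p q = q ⊞ (0ℤ ∷ˡ p)
subMul O p q = q
subMul I p q = q ⊟ p
subMul X p q = q ⊟ (0ℤ ∷ˡ p)

circDetPoly : ∀ {n} .{{_ : NonZero n}} → Vec Entry n → Poly
circDetPoly {n} v = fastDet []ˡ (1ℤ ∷ˡ []ˡ) addMul subMul n (λ i → tabulate (circ (lookup v) i))

module _ (x : ℚ) where
  private
    _≈ᴾ_ : Poly → ℚ → Set
    p ≈ᴾ q = eval p x ≡ q

    _∼ᴱ_ : Entry → ℚ → Set
    e ∼ᴱ q = value e x ≡ q

    1-≈ : (1ℤ ∷ˡ []ˡ) ≈ᴾ 1ℚ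
    1-≈ = cong (1ℚ ℚ.+_) (ℚ.*-zeroʳ x)

    plusVar : ∀ x u v → v ℚ.+ (0ℚ ℚ.+ x ℚ.* u) ≡ v ℚ.+ 1ℚ ℚ.* (x ℚ.* u)
    plusVar = solve 3 (λ x u v → v :+ (con 0ℚ :+ x :* u) := v :+ con 1ℚ :* (x :* u)) refl
      where open +-*-Solver

    minusVar : ∀ x u v → v ℚ.+ ℚ.- (0ℚ ℚ.+ x ℚ.* u) ≡ v ℚ.+ (ℚ.- 1ℚ) ℚ.* (x ℚ.* u)
    minusVar = solve 3 (λ x u v → v :+ :- (con 0ℚ :+ x :* u) := v :+ con (ℚ.- 1ℚ) :* (x :* u)) refl
      where open +-*-Solver

    addMul-≈ : MulAdd _∼ᴱ_ _≈ᴾ_ {[]ˡ} {1ℤ ∷ˡ []ˡ} refl 1-≈ 1ℚ addMul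
    addMul-≈ O _ _ {u = u} {v} refl _ b = trans b (plusZero 1ℚ u v)
    addMul-≈ I a b refl refl refl = trans (eval-⊞ b a x) (plusOne (eval a x) (eval b x))
    addMul-≈ X a b refl refl refl = trans (eval-⊞ b (0ℤ ∷ˡ a) x) (plusVar x (eval a x) (eval b x))

    subMul-≈ : MulAdd _∼ᴱ_ _≈ᴾ_ {[]ˡ} {1ℤ ∷ˡ []ˡ} refl 1-≈ (ℚ.- 1ℚ) subMul
    subMul-≈ O _ _ {u = u} {v} refl _ b = trans b (plusZero (ℚ.- 1ℚ) u v)
    subMul-≈ I a b refl refl refl = trans (eval-⊟ b a x) (minusOne (eval a x) (eval b x))
    subMul-≈ X a b refl refl refl = trans (eval-⊟ b (0ℤ ∷ˡ a) x) (minusVar x (eval a x) (eval b x))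

  circDetPoly-correct : ∀ {n} .{{_ : NonZero n}} (v : Vec Entry n) →
    eval (circDetPoly v) x ≡ detℚ (circ (λ i → value (lookup v i) x))
  circDetPoly-correct {n} v = fastDet-correct _∼ᴱ_ _≈ᴾ_ {[]ˡ} {1ℤ ∷ˡ []ˡ} refl 1-≈ addMul-≈ subMul-≈ n _ _
    (λ i j → cong (λ e → value e x) (lookup∘tabulate (circ (lookup v) i) j))

-- Rational estimates

private
  module Identities where
    open +-*-Solver
    cancelSub : ∀ p q → (p ℚ.- q) ℚ.+ q ≡ p
    cancelSub = solve 2 (λ p q → (p :- q) :+ q := p) refl
    cancelAdd : ∀ p q → (q ℚ.+ p) ℚ.- q ≡ p
    cancelAdd = solve 2 (λ p q → (q :+ p) :- q := p) refl
    swapSub : ∀ p q → ℚ.- (p ℚ.- q) ≡ q ℚ.- p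
    swapSub = solve 2 (λ p q → :- (p :- q) := q :- p) refl
    subSub : ∀ p q → p ℚ.- (p ℚ.- q) ≡ q
    subSub = solve 2 (λ p q → p :- (p :- q) := q) refl
    regroup-+ : ∀ a b c d → (a ℚ.+ b) ℚ.- (c ℚ.+ d) ≡ (a ℚ.- c) ℚ.+ (b ℚ.- d)
    regroup-+ = solve 4 (λ a b c d → (a :+ b) :- (c :+ d) := (a :- c) :+ (b :- d)) refl
    regroup-* : ∀ a b c d → a ℚ.* b ℚ.- c ℚ.* d ≡ a ℚ.* (b ℚ.- d) ℚ.+ (a ℚ.- c) ℚ.* d
    regroup-* = solve 4 (λ a b c d → a :* b :- c :* d := a :* (b :- d) :+ (a :- c) :* d) refl
    regroup-neg : ∀ a b → (ℚ.- a) ℚ.- (ℚ.- b) ≡ ℚ.- (a ℚ.- b)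
    regroup-neg = solve 2 (λ a b → (:- a) :- (:- b) := :- (a :- b)) refl
    slope-* : ∀ B K L C δ → B ℚ.* (L ℚ.* δ) ℚ.+ (K ℚ.* δ) ℚ.* (C ℚ.+ L) ≡ (B ℚ.* L ℚ.+ K ℚ.* (C ℚ.+ L)) ℚ.* δ
    slope-* = solve 5 (λ B K L C δ → B :* (L :* δ) :+ (K :* δ) :* (C :+ L) := (B :* L :+ K :* (C :+ L)) :* δ) refl
    halves : ∀ p → ½ ℚ.* p ℚ.+ ½ ℚ.* p ≡ p
    halves = solve 1 (λ p → con ½ :* p :+ con ½ :* p := p) refl

open Identities

p≤∣p∣ : ∀ p → p ℚ.≤ ℚ.∣ p ∣
p≤∣p∣ p with ℚ.≤-total 0ℚ p
... | inj₁ 0≤p = ℚ.≤-reflexive (sym (ℚ.0≤p⇒∣p∣≡p 0≤p))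
... | inj₂ p≤0 = ℚ.≤-trans p≤0 (ℚ.0≤∣p∣ p)

∣p∣≤⁺ : ∀ {p δ} → p ℚ.≤ δ → ℚ.- p ℚ.≤ δ → ℚ.∣ p ∣ ℚ.≤ δ
∣p∣≤⁺ {p} p≤δ -p≤δ with ℚ.∣p∣≡p∨∣p∣≡-p p
... | inj₁ eq = subst (ℚ._≤ _) (sym eq) p≤δ
... | inj₂ eq = subst (ℚ._≤ _) (sym eq) -p≤δ

p≤q+r⇒p-q≤r : ∀ {p q r} → p ℚ.≤ q ℚ.+ r → p ℚ.- q ℚ.≤ r
p≤q+r⇒p-q≤r {p} {q} {r} le = subst (p ℚ.- q ℚ.≤_) (cancelAdd r q) (ℚ.+-monoˡ-≤ (ℚ.- q) le)

p-q≤r⇒p≤q+r : ∀ {p q r} → p ℚ.- q ℚ.≤ r → p ℚ.≤ q ℚ.+ r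
p-q≤r⇒p≤q+r {p} {q} {r} le =
  subst₂ ℚ._≤_ (cancelSub p q) (ℚ.+-comm r q) (ℚ.+-monoˡ-≤ q le)

∣p-q∣≤⁺ : ∀ {p q δ} → p ℚ.≤ q ℚ.+ δ → q ℚ.≤ p ℚ.+ δ → ℚ.∣ p ℚ.- q ∣ ℚ.≤ δ
∣p-q∣≤⁺ {p} {q} p≤q+δ q≤p+δ = ∣p∣≤⁺ (p≤q+r⇒p-q≤r p≤q+δ)
  (subst (ℚ._≤ _) (sym (swapSub p q)) (p≤q+r⇒p-q≤r q≤p+δ))

∣p-q∣≤⇒p≤q+ : ∀ {p q δ} → ℚ.∣ p ℚ.- q ∣ ℚ.≤ δ → p ℚ.≤ q ℚ.+ δ
∣p-q∣≤⇒p≤q+ {p} {q} le = p-q≤r⇒p≤q+r (ℚ.≤-trans (p≤∣p∣ (p ℚ.- q)) le)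

∣p-q∣≡∣q-p∣ : ∀ p q → ℚ.∣ p ℚ.- q ∣ ≡ ℚ.∣ q ℚ.- p ∣
∣p-q∣≡∣q-p∣ p q = trans (sym (ℚ.∣-p∣≡∣p∣ (p ℚ.- q))) (cong ℚ.∣_∣ (swapSub p q))

∣∣p∣-∣q∣∣≤∣p-q∣ : ∀ p q → ℚ.∣ ℚ.∣ p ∣ ℚ.- ℚ.∣ q ∣ ∣ ℚ.≤ ℚ.∣ p ℚ.- q ∣
∣∣p∣-∣q∣∣≤∣p-q∣ p q = ∣p-q∣≤⁺ (half p q)
  (subst (λ d → ℚ.∣ q ∣ ℚ.≤ ℚ.∣ p ∣ ℚ.+ d) (∣p-q∣≡∣q-p∣ q p) (half q p))
  where
  half : ∀ p q → ℚ.∣ p ∣ ℚ.≤ ℚ.∣ q ∣ ℚ.+ ℚ.∣ p ℚ.- q ∣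
  half p q = subst₂ ℚ._≤_ (cong ℚ.∣_∣ (cancelSub p q)) (ℚ.+-comm ℚ.∣ p ℚ.- q ∣ ℚ.∣ q ∣)
    (ℚ.∣p+q∣≤∣p∣+∣q∣ (p ℚ.- q) q)

*-mono-≤-nonNeg : ∀ {p q r s} → 0ℚ ℚ.≤ q → 0ℚ ℚ.≤ r → p ℚ.≤ r → q ℚ.≤ s → p ℚ.* q ℚ.≤ r ℚ.* s
*-mono-≤-nonNeg {p} {q} {r} {s} 0≤q 0≤r p≤r q≤s = ℚ.≤-trans
  (ℚ.*-monoʳ-≤-nonNeg q {{ℚ.nonNegative 0≤q}} p≤r)
  (ℚ.*-monoˡ-≤-nonNeg r {{ℚ.nonNegative 0≤r}} q≤s)

0≤p*q : ∀ {p q} → 0ℚ ℚ.≤ p → 0ℚ ℚ.≤ q → 0ℚ ℚ.≤ p ℚ.* q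
0≤p*q {p} {q} 0≤p 0≤q = ℚ.nonNegative⁻¹ _
  {{ℚ.nonNeg*nonNeg⇒nonNeg p {{ℚ.nonNegative 0≤p}} q {{ℚ.nonNegative 0≤q}}}}

0<p*q : ∀ {p q} → 0ℚ ℚ.< p → 0ℚ ℚ.< q → 0ℚ ℚ.< p ℚ.* q
0<p*q {p} {q} 0<p 0<q = ℚ.positive⁻¹ _
  {{ℚ.pos*pos⇒pos p {{ℚ.positive 0<p}} q {{ℚ.positive 0<q}}}}

0<½*p : ∀ {p} → 0ℚ ℚ.< p → 0ℚ ℚ.< ½ ℚ.* p
0<½*p = 0<p*q (ℚ.positive⁻¹ ½)

∣p*q∣≤ : ∀ {p q B C} → ℚ.∣ p ∣ ℚ.≤ B → ℚ.∣ q ∣ ℚ.≤ C → ℚ.∣ p ℚ.* q ∣ ℚ.≤ B ℚ.* C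
∣p*q∣≤ {p} {q} {B} {C} p≤ q≤ = subst (ℚ._≤ B ℚ.* C) (sym (ℚ.∣p*q∣≡∣p∣*∣q∣ p q))
  (*-mono-≤-nonNeg (ℚ.0≤∣p∣ q) (ℚ.≤-trans (ℚ.0≤∣p∣ p) p≤) p≤ q≤)

-- The step solves (K + η) δ = η.
smallStep : ∀ K η → 0ℚ ℚ.≤ K → 0ℚ ℚ.< η →
  ∃ λ δ → 0ℚ ℚ.< δ × δ ℚ.≤ 1ℚ × K ℚ.* δ ℚ.< η
smallStep K η 0≤K 0<η = δ , 0<δ , δ≤1 , Kδ<η
  where
  open ℚ.≤-Reasoning
  S : ℚ
  S = K ℚ.+ η
  instance
    S-pos : ℚ.Positive S
    S-pos = ℚ.nonNeg+pos⇒pos K {{ℚ.nonNegative 0≤K}} η {{ℚ.positive 0<η}}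
    S-nonZero : ℚ.NonZero S
    S-nonZero = ℚ.pos⇒nonZero S
  δ : ℚ
  δ = ℚ.1/ S ℚ.* η
  0<δ : 0ℚ ℚ.< δ
  0<δ = 0<p*q (ℚ.positive⁻¹ (ℚ.1/ S) {{ℚ.1/pos⇒pos S}}) 0<η
  Sδ≡η : S ℚ.* δ ≡ η
  Sδ≡η = trans (sym (ℚ.*-assoc S (ℚ.1/ S) η))
    (trans (cong (ℚ._* η) (ℚ.*-inverseʳ S)) (ℚ.*-identityˡ η))
  δ≤1 : δ ℚ.≤ 1ℚ
  δ≤1 = ℚ.*-cancelˡ-≤-pos S (begin
    S ℚ.* δ    ≡⟨ Sδ≡η ⟩
    η          ≡⟨ ℚ.+-identityˡ η ⟨
    0ℚ ℚ.+ η   ≤⟨ ℚ.+-monoˡ-≤ η 0≤K ⟩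
    S          ≡⟨ ℚ.*-identityʳ S ⟨
    S ℚ.* 1ℚ   ∎)
  Kδ<η : K ℚ.* δ ℚ.< η
  Kδ<η = begin-strict
    K ℚ.* δ              ≡⟨ ℚ.+-identityʳ (K ℚ.* δ) ⟨
    K ℚ.* δ ℚ.+ 0ℚ       <⟨ ℚ.+-monoʳ-< (K ℚ.* δ) (0<p*q 0<η 0<δ) ⟩
    K ℚ.* δ ℚ.+ η ℚ.* δ  ≡⟨ ℚ.*-distribʳ-+ δ K η ⟨
    S ℚ.* δ              ≡⟨ Sδ≡η ⟩
    η                    ∎

-- Eventual properties and the order on ℝ

Eventually : (ℕ → Set) → Set
Eventually P = ∃ λ N → ∀ n → N ℕ.≤ n → P n

Eventually-zip : ∀ {P Q R : ℕ → Set} → (∀ n → P n → Q n → R n) →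
                 Eventually P → Eventually Q → Eventually R
Eventually-zip f (M , p) (N , q) = M ℕ.⊔ N , λ n le →
  f n (p n (ℕ.m⊔n≤o⇒m≤o M N le)) (q n (ℕ.m⊔n≤o⇒n≤o M N le))

Eventually-map : ∀ {P Q : ℕ → Set} → (∀ n → P n → Q n) → Eventually P → Eventually Q
Eventually-map f (N , p) = N , λ n le → f n (p n le)

Eventually-∀ : ∀ {k} {P : Fin k → ℕ → Set} → (∀ i → Eventually (P i)) →
               Eventually (λ n → ∀ i → P i n)
Eventually-∀ {zero}  ev = 0 , λ _ _ ()
Eventually-∀ {suc k} ev = Eventually-zip (λ { n p ps zero → p ; n p ps (suc i) → ps i })
  (ev zero) (Eventually-∀ (λ i → ev (suc i)))

≃-refl : ∀ x → x ≃ x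
≃-refl x ε 0<ε = 0 , λ n _ → subst (ℚ._< ε) (sym (cong ℚ.∣_∣ (ℚ.+-inverseʳ (seq x n)))) 0<ε

≃-sym : ∀ x y → x ≃ y → y ≃ x
≃-sym x y x≃y ε 0<ε = Eventually-map
  (λ n → subst (ℚ._< ε) (∣p-q∣≡∣q-p∣ (seq x n) (seq y n))) (x≃y ε 0<ε)

≃⇒≤ : ∀ x y → x ≃ y → x ≤ y
≃⇒≤ x y x≃y ε 0<ε = Eventually-map
  (λ n lt → subst₂ ℚ._<_ (cancelSub (seq x n) (seq y n)) (ℚ.+-comm ε (seq y n))
    (ℚ.+-monoˡ-< (seq y n) (ℚ.≤-<-trans (p≤∣p∣ _) lt))) (x≃y ε 0<ε)

≤-trans : ∀ x y z → x ≤ y → y ≤ z → x ≤ z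
≤-trans x y z x≤y y≤z ε 0<ε = Eventually-zip
  (λ n p q → begin-strict
    seq x n                                <⟨ p ⟩
    seq y n ℚ.+ ½ ℚ.* ε                    <⟨ ℚ.+-monoˡ-< (½ ℚ.* ε) q ⟩
    (seq z n ℚ.+ ½ ℚ.* ε) ℚ.+ ½ ℚ.* ε      ≡⟨ ℚ.+-assoc (seq z n) (½ ℚ.* ε) (½ ℚ.* ε) ⟩
    seq z n ℚ.+ (½ ℚ.* ε ℚ.+ ½ ℚ.* ε)      ≡⟨ cong (seq z n ℚ.+_) (halves ε) ⟩
    seq z n ℚ.+ ε                          ∎)
  (x≤y (½ ℚ.* ε) (0<½*p 0<ε)) (y≤z (½ ℚ.* ε) (0<½*p 0<ε))
  where open ℚ.≤-Reasoning

<-≤-trans : ∀ x y z → x < y → y ≤ z → x < z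
<-≤-trans x y z (ε , 0<ε , x<y) y≤z = ½ ℚ.* ε , 0<½*p 0<ε , Eventually-zip
  (λ n p q → begin-strict
    seq x n ℚ.+ η                          ≡⟨ cancelAdd (seq x n ℚ.+ η) η ⟨
    (η ℚ.+ (seq x n ℚ.+ η)) ℚ.- η          ≡⟨ cong (ℚ._- η) (regroup η (seq x n)) ⟩
    (seq x n ℚ.+ (η ℚ.+ η)) ℚ.- η          ≡⟨ cong (λ e → (seq x n ℚ.+ e) ℚ.- η) (halves ε) ⟩
    (seq x n ℚ.+ ε) ℚ.- η                  <⟨ ℚ.+-monoˡ-< (ℚ.- η) (ℚ.<-trans p q) ⟩
    (seq z n ℚ.+ η) ℚ.- η                  ≡⟨ cong (ℚ._- η) (ℚ.+-comm (seq z n) η) ⟩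
    (η ℚ.+ seq z n) ℚ.- η                  ≡⟨ cancelAdd (seq z n) η ⟩
    seq z n                                ∎)
  x<y (y≤z η (0<½*p 0<ε))
  where
  open ℚ.≤-Reasoning
  η : ℚ
  η = ½ ℚ.* ε
  regroup : ∀ e x → e ℚ.+ (x ℚ.+ e) ≡ x ℚ.+ (e ℚ.+ e)
  regroup = solve 2 (λ e x → e :+ (x :+ e) := x :+ (e :+ e)) refl
    where open +-*-Solver

<⇒≱ : ∀ x y → x < y → ¬ (y ≤ x)
<⇒≱ x y (ε , 0<ε , N , x<y) y≤x with y≤x ε 0<ε
... | N′ , y<x = ℚ.<-asym
  (x<y (N ℕ.⊔ N′) (ℕ.m≤m⊔n N N′)) (y<x (N ℕ.⊔ N′) (ℕ.m≤n⊔m N N′))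

fromℚ-mono-≤ : ∀ {p q} → p ℚ.≤ q → fromℚ p ≤ fromℚ q
fromℚ-mono-≤ {p} {q} p≤q ε 0<ε = 0 , λ _ _ → ℚ.≤-<-trans p≤q
  (subst (ℚ._< q ℚ.+ ε) (ℚ.+-identityʳ q) (ℚ.+-monoʳ-< q 0<ε))

seq≡⇒≃ : ∀ x y → (∀ n → seq x n ≡ seq y n) → x ≃ y
seq≡⇒≃ x y eq ε 0<ε = 0 , λ n _ → subst (ℚ._< ε)
  (sym (trans (cong (λ p → ℚ.∣ p ℚ.- seq y n ∣) (eq n)) (cong ℚ.∣_∣ (ℚ.+-inverseʳ (seq y n))))) 0<ε

-- The bridge from ℝ to ℚ: taking the `m`-th term commutes with the operations definitionally, hence
-- with `det` by parametricity.
seq-det : ∀ {n} (M : SquareMatrix ℝ n) m → seq (det M) m ≡ detℚ (λ i j → seq (M i j) m)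
seq-det M m = det-related ℝ-rawRing ℚ.+-*-rawRing (λ x q → seq x m ≡ q)
  (cong₂ ℚ._+_) (cong₂ ℚ._*_) (cong λ p → ℚ.- p) refl refl {M = M} (λ _ _ → refl)

-- Lipschitz functions on the unit cube

Unit : ∀ {n} → Vector ℚ n → Set
Unit x = ∀ i → 0ℚ ℚ.≤ x i × x i ℚ.≤ 1ℚ

-- Only the first point is asked to lie in the cube, because the terms of a
-- Cauchy sequence with limit in [0,1] need not do so.
record Lipschitz {n} (g : Vector ℚ n → ℚ) : Set where
  field
    bound slope : ℚ
    0≤bound     : 0ℚ ℚ.≤ bound
    0≤slope     : 0ℚ ℚ.≤ slope
    bounded     : ∀ x → Unit x → ℚ.∣ g x ∣ ℚ.≤ bound
    lipschitz   : ∀ x → Unit x → ∀ y δ → 0ℚ ℚ.≤ δ → δ ℚ.≤ 1ℚ →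
                  (∀ i → ℚ.∣ x i ℚ.- y i ∣ ℚ.≤ δ) → ℚ.∣ g x ℚ.- g y ∣ ℚ.≤ slope ℚ.* δ

functionRing : ℕ → RawRing 0ℓ 0ℓ
functionRing n = record
  { Carrier = Vector ℚ n → ℚ
  ; _≈_     = λ g h → ∀ x → g x ≡ h x
  ; _+_     = λ g h x → g x ℚ.+ h x
  ; _*_     = λ g h x → g x ℚ.* h x
  ; -_      = λ g x → ℚ.- g x
  ; 0#      = λ _ → 0ℚ
  ; 1#      = λ _ → 1ℚ
  }

module _ {n : ℕ} where
  open Lipschitz

  const-lipschitz : ∀ q → Lipschitz {n} (λ _ → q)
  const-lipschitz q = record
    { bound     = ℚ.∣ q ∣
    ; slope     = 0ℚ
    ; 0≤bound   = ℚ.0≤∣p∣ q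
    ; 0≤slope   = ℚ.≤-refl
    ; bounded   = λ _ _ → ℚ.≤-refl
    ; lipschitz = λ _ _ _ δ _ _ _ → ℚ.≤-reflexive
        (trans (cong ℚ.∣_∣ (ℚ.+-inverseʳ q)) (sym (ℚ.*-zeroˡ δ)))
    }

  coordinate-lipschitz : ∀ i → Lipschitz {n} (λ x → x i)
  coordinate-lipschitz i = record
    { bound     = 1ℚ
    ; slope     = 1ℚ
    ; 0≤bound   = ℚ.nonNegative⁻¹ 1ℚ
    ; 0≤slope   = ℚ.nonNegative⁻¹ 1ℚ
    ; bounded   = λ x ux → subst (ℚ._≤ 1ℚ) (sym (ℚ.0≤p⇒∣p∣≡p (proj₁ (ux i)))) (proj₂ (ux i))
    ; lipschitz = λ _ _ _ δ _ _ near → subst (_ ℚ.≤_) (sym (ℚ.*-identityˡ δ)) (near i)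
    }

  +-lipschitz : ∀ {g h} → Lipschitz {n} g → Lipschitz h → Lipschitz (λ x → g x ℚ.+ h x)
  +-lipschitz {g} {h} G H = record
    { bound     = bound G ℚ.+ bound H
    ; slope     = slope G ℚ.+ slope H
    ; 0≤bound   = ℚ.+-mono-≤ (0≤bound G) (0≤bound H)
    ; 0≤slope   = ℚ.+-mono-≤ (0≤slope G) (0≤slope H)
    ; bounded   = λ x ux → ℚ.≤-trans (ℚ.∣p+q∣≤∣p∣+∣q∣ (g x) (h x))
                    (ℚ.+-mono-≤ (bounded G x ux) (bounded H x ux))
    ; lipschitz = λ x ux y δ 0≤δ δ≤1 near → begin
        ℚ.∣ (g x ℚ.+ h x) ℚ.- (g y ℚ.+ h y) ∣        ≡⟨ cong ℚ.∣_∣ (regroup-+ (g x) (h x) (g y) (h y)) ⟩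
        ℚ.∣ (g x ℚ.- g y) ℚ.+ (h x ℚ.- h y) ∣        ≤⟨ ℚ.∣p+q∣≤∣p∣+∣q∣ (g x ℚ.- g y) (h x ℚ.- h y) ⟩
        ℚ.∣ g x ℚ.- g y ∣ ℚ.+ ℚ.∣ h x ℚ.- h y ∣      ≤⟨ ℚ.+-mono-≤ (lipschitz G x ux y δ 0≤δ δ≤1 near) (lipschitz H x ux y δ 0≤δ δ≤1 near) ⟩
        slope G ℚ.* δ ℚ.+ slope H ℚ.* δ              ≡⟨ ℚ.*-distribʳ-+ δ (slope G) (slope H) ⟨
        (slope G ℚ.+ slope H) ℚ.* δ                  ∎
    }
    where open ℚ.≤-Reasoning

  neg-lipschitz : ∀ {g} → Lipschitz {n} g → Lipschitz (λ x → ℚ.- g x)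
  neg-lipschitz {g} G = record
    { bound     = bound G
    ; slope     = slope G
    ; 0≤bound   = 0≤bound G
    ; 0≤slope   = 0≤slope G
    ; bounded   = λ x ux → subst (ℚ._≤ bound G) (sym (ℚ.∣-p∣≡∣p∣ (g x))) (bounded G x ux)
    ; lipschitz = λ x ux y δ 0≤δ δ≤1 near → subst (ℚ._≤ slope G ℚ.* δ)
        (sym (trans (cong ℚ.∣_∣ (regroup-neg (g x) (g y))) (ℚ.∣-p∣≡∣p∣ (g x ℚ.- g y))))
        (lipschitz G x ux y δ 0≤δ δ≤1 near)
    }

  abs-lipschitz : ∀ {g} → Lipschitz {n} g → Lipschitz (λ x → ℚ.∣ g x ∣)
  abs-lipschitz {g} G = record
    { bound     = bound G
    ; slope     = slope G
    ; 0≤bound   = 0≤bound G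
    ; 0≤slope   = 0≤slope G
    ; bounded   = λ x ux → subst (ℚ._≤ bound G) (sym (ℚ.∣∣p∣∣≡∣p∣ (g x))) (bounded G x ux)
    ; lipschitz = λ x ux y δ 0≤δ δ≤1 near → ℚ.≤-trans (∣∣p∣-∣q∣∣≤∣p-q∣ (g x) (g y))
        (lipschitz G x ux y δ 0≤δ δ≤1 near)
    }

  -- The point `y` may lie outside the cube, where `bound H` says nothing about `h y`. It is
  -- controlled through `x` instead: since δ ≤ 1, `h y` exceeds `bound H` in absolute value by at
  -- most `slope H`, and this is the origin of the last factor of the slope.
  *-lipschitz : ∀ {g h} → Lipschitz {n} g → Lipschitz h → Lipschitz (λ x → g x ℚ.* h x)
  *-lipschitz {g} {h} G H = record
    { bound     = bound G ℚ.* bound H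
    ; slope     = bound G ℚ.* slope H ℚ.+ slope G ℚ.* (bound H ℚ.+ slope H)
    ; 0≤bound   = 0≤p*q (0≤bound G) (0≤bound H)
    ; 0≤slope   = ℚ.+-mono-≤ (0≤p*q (0≤bound G) (0≤slope H))
                    (0≤p*q (0≤slope G) (ℚ.+-mono-≤ (0≤bound H) (0≤slope H)))
    ; bounded   = λ x ux → ∣p*q∣≤ (bounded G x ux) (bounded H x ux)
    ; lipschitz = λ x ux y δ 0≤δ δ≤1 near →
        let g-close = lipschitz G x ux y δ 0≤δ δ≤1 near
            h-close = lipschitz H x ux y δ 0≤δ δ≤1 near
            hy≤ : ℚ.∣ h y ∣ ℚ.≤ bound H ℚ.+ slope H
            hy≤ = begin
              ℚ.∣ h y ∣                              ≡⟨ cong ℚ.∣_∣ (subSub (h x) (h y)) ⟨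
              ℚ.∣ h x ℚ.- (h x ℚ.- h y) ∣            ≤⟨ ℚ.∣p-q∣≤∣p∣+∣q∣ (h x) (h x ℚ.- h y) ⟩
              ℚ.∣ h x ∣ ℚ.+ ℚ.∣ h x ℚ.- h y ∣        ≤⟨ ℚ.+-mono-≤ (bounded H x ux) h-close ⟩
              bound H ℚ.+ slope H ℚ.* δ              ≤⟨ ℚ.+-monoʳ-≤ (bound H) (ℚ.*-monoˡ-≤-nonNeg (slope H) {{ℚ.nonNegative (0≤slope H)}} δ≤1) ⟩
              bound H ℚ.+ slope H ℚ.* 1ℚ             ≡⟨ cong (bound H ℚ.+_) (ℚ.*-identityʳ (slope H)) ⟩
              bound H ℚ.+ slope H                    ∎
        in begin
        ℚ.∣ g x ℚ.* h x ℚ.- g y ℚ.* h y ∣                              ≡⟨ cong ℚ.∣_∣ (regroup-* (g x) (h x) (g y) (h y)) ⟩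
        ℚ.∣ g x ℚ.* (h x ℚ.- h y) ℚ.+ (g x ℚ.- g y) ℚ.* h y ∣          ≤⟨ ℚ.∣p+q∣≤∣p∣+∣q∣ (g x ℚ.* (h x ℚ.- h y)) ((g x ℚ.- g y) ℚ.* h y) ⟩
        ℚ.∣ g x ℚ.* (h x ℚ.- h y) ∣ ℚ.+ ℚ.∣ (g x ℚ.- g y) ℚ.* h y ∣    ≤⟨ ℚ.+-mono-≤ (∣p*q∣≤ (bounded G x ux) h-close) (∣p*q∣≤ g-close hy≤) ⟩
        bound G ℚ.* (slope H ℚ.* δ) ℚ.+ (slope G ℚ.* δ) ℚ.* (bound H ℚ.+ slope H)
                                                                       ≡⟨ slope-* (bound G) (slope G) (slope H) (bound H) δ ⟩
        (bound G ℚ.* slope H ℚ.+ slope G ℚ.* (bound H ℚ.+ slope H)) ℚ.* δ  ∎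
    }
    where open ℚ.≤-Reasoning

  Lipschitz-resp : ∀ {g h} → (∀ x → g x ≡ h x) → Lipschitz {n} g → Lipschitz h
  Lipschitz-resp {g} {h} g≡h G = record
    { bound     = bound G
    ; slope     = slope G
    ; 0≤bound   = 0≤bound G
    ; 0≤slope   = 0≤slope G
    ; bounded   = λ x ux → subst (λ q → ℚ.∣ q ∣ ℚ.≤ _) (g≡h x) (bounded G x ux)
    ; lipschitz = λ x ux y δ 0≤δ δ≤1 near →
        subst₂ (λ p q → ℚ.∣ p ℚ.- q ∣ ℚ.≤ _) (g≡h x) (g≡h y) (lipschitz G x ux y δ 0≤δ δ≤1 near)
    }

  -- Parametricity is used twice: evaluation at `x` identifies the determinant formed in
  -- `functionRing` with the pointwise one, and the predicate `Lipschitz` passes through the Laplace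
  -- recursion of the former.
  det-lipschitz : ∀ {k} (M : SquareMatrix (Vector ℚ n → ℚ) k) → (∀ i j → Lipschitz (M i j)) →
                  Lipschitz (λ x → detℚ (λ i j → M i j x))
  det-lipschitz M M-lipschitz = Lipschitz-resp
    (λ x → det-related (functionRing n) ℚ.+-*-rawRing (λ g q → g x ≡ q)
      (cong₂ ℚ._+_) (cong₂ ℚ._*_) (cong λ p → ℚ.- p) refl refl {M = M} (λ _ _ → refl))
    (det-related (functionRing n) (functionRing n) (λ g _ → Lipschitz g)
      +-lipschitz *-lipschitz neg-lipschitz (const-lipschitz 0ℚ) (const-lipschitz 1ℚ)
      {M = M} {N = M} M-lipschitz)

absDet : ∀ {n} .{{_ : NonZero n}} → Vector ℚ n → ℚ
absDet x = ℚ.∣ detℚ (circ x) ∣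

absDet-lipschitz : ∀ {n} .{{_ : NonZero n}} → Lipschitz (absDet {n})
absDet-lipschitz = abs-lipschitz (det-lipschitz (λ i j x → circ x i j) (λ i j → coordinate-lipschitz _))

seq-absDet : ∀ {n} .{{_ : NonZero n}} (a : Vector ℝ n) m →
             seq ∣ det (circ a) ∣ m ≡ absDet (λ i → seq (a i) m)
seq-absDet a m = cong ℚ.∣_∣ (seq-det (circ a) m)

-- Halving

width : ℕ → ℚ
width zero    = 1ℚ
width (suc k) = ½ ℚ.* width k

0<width : ∀ k → 0ℚ ℚ.< width k
0<width zero    = ℚ.positive⁻¹ 1ℚ
0<width (suc k) = 0<½*p (0<width k)

fromℤ-suc : ∀ k → fromℤ (+ suc k) ≡ 1ℚ ℚ.+ fromℤ (+ k)
fromℤ-suc k = fromℤ-homo-+ 1ℤ (+ k)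

0≤fromℤ : ∀ k → 0ℚ ℚ.≤ fromℤ (+ k)
0≤fromℤ zero    = ℚ.≤-refl
0≤fromℤ (suc k) = subst (0ℚ ℚ.≤_) (sym (fromℤ-suc k))
  (ℚ.+-mono-≤ (ℚ.nonNegative⁻¹ 1ℚ) (0≤fromℤ k))

-- The crude bound 2^-k ≤ 1/(k+1); passing to `suc k` halves the width and at most doubles the other
-- factor.
width*suc≤1 : ∀ k → width k ℚ.* fromℤ (+ suc k) ℚ.≤ 1ℚ
width*suc≤1 zero    = ℚ.≤-refl
width*suc≤1 (suc k) = begin
  (½ ℚ.* w) ℚ.* fromℤ (+ suc (suc k))    ≡⟨ cong ((½ ℚ.* w) ℚ.*_) (fromℤ-suc (suc k)) ⟩
  (½ ℚ.* w) ℚ.* (1ℚ ℚ.+ s)               ≤⟨ ℚ.*-monoˡ-≤-nonNeg (½ ℚ.* w) {{ℚ.nonNegative (ℚ.<⇒≤ (0<width (suc k)))}} (ℚ.+-monoˡ-≤ s 1≤s) ⟩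
  (½ ℚ.* w) ℚ.* (s ℚ.+ s)                ≡⟨ regroup w s ⟩
  w ℚ.* s                                ≤⟨ width*suc≤1 k ⟩
  1ℚ                                     ∎
  where
  open ℚ.≤-Reasoning
  w s : ℚ
  w = width k
  s = fromℤ (+ suc k)
  1≤s : 1ℚ ℚ.≤ s
  1≤s = subst₂ ℚ._≤_ (ℚ.+-identityʳ 1ℚ) (sym (fromℤ-suc k)) (ℚ.+-monoʳ-≤ 1ℚ (0≤fromℤ k))
  regroup : ∀ w s → (½ ℚ.* w) ℚ.* (s ℚ.+ s) ≡ w ℚ.* s
  regroup = solve 2 (λ w s → (con ½ :* w) :* (s :+ s) := w :* s) refl
    where open +-*-Solver

-- A positive numerator is at least 1. This makes the denominator an explicit Archimedean witness.
1≤p*↧p : ∀ p → 0ℚ ℚ.< p → 1ℚ ℚ.≤ p ℚ.* fromℤ (+ ↧ₙ p)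
1≤p*↧p p@(mkℚ (+ zero)   d-1 _) 0<p with ℚ.positive 0<p
... | ()
1≤p*↧p p@(mkℚ (-[1+ n ]) d-1 _) 0<p with ℚ.positive 0<p
... | ()
1≤p*↧p p@(mkℚ (+[1+ n ]) d-1 _) 0<p = ℚ.toℚᵘ-cancel-≤ (begin
  mkℚᵘ 1ℤ 0                                       ≤⟨ *≤* (ℤ.≤-trans (ℤ.≤-reflexive (cong +_ lhs)) (ℤ.≤-trans (ℤ.+≤+ (ℕ.m≤m+n (suc d-1) (n ℕ.* suc d-1))) (ℤ.≤-reflexive (cong +_ rhs)))) ⟩
  mkℚᵘ (+[1+ n ]) d-1 ℚᵘ.* mkℚᵘ (+ suc d-1) 0     ≃⟨ ℚᵘ.*-congˡ {mkℚᵘ (+[1+ n ]) d-1} (ℚ.toℚᵘ-fromℚᵘ (mkℚᵘ (+ suc d-1) 0)) ⟨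
  ℚ.toℚᵘ p ℚᵘ.* ℚ.toℚᵘ (fromℤ (+ suc d-1))        ≃⟨ ℚ.toℚᵘ-homo-* p (fromℤ (+ suc d-1)) ⟨
  ℚ.toℚᵘ (p ℚ.* fromℤ (+ suc d-1))                ∎)
  where
  open ℚᵘ.≤-Reasoning
  lhs : 1 ℕ.* (suc d-1 ℕ.* 1) ≡ suc d-1
  lhs = trans (ℕ.*-identityˡ _) (ℕ.*-identityʳ _)
  rhs : suc n ℕ.* suc d-1 ≡ suc n ℕ.* suc d-1 ℕ.* 1
  rhs = sym (ℕ.*-identityʳ _)

-- With `k` the denominator of ε, 2^-k ≤ 1/(k+1) ≤ 1/k ≤ ε.
width→0 : ∀ ε → 0ℚ ℚ.< ε → ∃ λ k → width k ℚ.≤ ε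
width→0 ε 0<ε = k , ℚ.*-cancelʳ-≤-pos s {{ℚ.positive 0<s}} (begin
  width k ℚ.* s          ≤⟨ width*suc≤1 k ⟩
  1ℚ                     ≤⟨ 1≤p*↧p ε 0<ε ⟩
  ε ℚ.* fromℤ (+ k)      ≤⟨ ℚ.*-monoˡ-≤-nonNeg ε {{ℚ.nonNegative (ℚ.<⇒≤ 0<ε)}} k≤s ⟩
  ε ℚ.* s                ∎)
  where
  open ℚ.≤-Reasoning
  k : ℕ
  k = ↧ₙ ε
  s : ℚ
  s = fromℤ (+ suc k)
  0<s : 0ℚ ℚ.< s
  0<s = subst (0ℚ ℚ.<_) (sym (fromℤ-suc k)) (ℚ.+-mono-<-≤ (ℚ.positive⁻¹ 1ℚ) (0≤fromℤ k))
  k≤s : fromℤ (+ k) ℚ.≤ s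
  k≤s = subst₂ ℚ._≤_ (ℚ.+-identityˡ _) (sym (fromℤ-suc k))
    (ℚ.+-monoˡ-≤ (fromℤ (+ k)) (ℚ.nonNegative⁻¹ 1ℚ))

-- The extreme value theorem on the cube

-- Clamping to [0,1]. Domination speaks only of points of the cube, whereas the terms of a real in
-- [0,1] may overshoot by δ.
nearestInUnit : ∀ x δ → 0ℚ ℚ.≤ δ → 0ℚ ℚ.≤ x ℚ.+ δ → x ℚ.≤ 1ℚ ℚ.+ δ →
  ∃ λ c → (0ℚ ℚ.≤ c × c ℚ.≤ 1ℚ) × ℚ.∣ c ℚ.- x ∣ ℚ.≤ δ
nearestInUnit x δ 0≤δ 0≤x+δ x≤1+δ with ℚ.≤-total 0ℚ x | ℚ.≤-total x 1ℚ
... | inj₂ x≤0 | _ = 0ℚ , (ℚ.≤-refl , ℚ.nonNegative⁻¹ 1ℚ) ,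
  ∣p-q∣≤⁺ 0≤x+δ (ℚ.≤-trans x≤0 (subst (0ℚ ℚ.≤_) (sym (ℚ.+-identityˡ δ)) 0≤δ))
... | inj₁ 0≤x | inj₁ x≤1 = x , (0≤x , x≤1) ,
  subst (ℚ._≤ δ) (sym (cong ℚ.∣_∣ (ℚ.+-inverseʳ x))) 0≤δ
... | inj₁ 0≤x | inj₂ 1≤x = 1ℚ , (ℚ.nonNegative⁻¹ 1ℚ , ℚ.≤-refl) ,
  ∣p-q∣≤⁺ (ℚ.≤-trans 1≤x (subst (ℚ._≤ x ℚ.+ δ) (ℚ.+-identityʳ x) (ℚ.+-monoʳ-≤ x 0≤δ))) x≤1+δ

module ExtremeValue (em : ExcludedMiddle 0ℓ) {n} (f : Vector ℚ n → ℚ) where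

  Dominating : (Vector ℚ n → Set) → Set
  Dominating Q = ∀ x → Unit x → ∃ λ y → Unit y × Q y × f x ℚ.≤ f y

  Dominating-map : ∀ {Q R} → (∀ y → Q y → R y) → Dominating Q → Dominating R
  Dominating-map Q⇒R dom x ux =
    let y , uy , qy , fx≤fy = dom x ux in y , uy , Q⇒R y qy , fx≤fy

  -- If x₀ is not dominated in the first part, then for every x the larger of
  -- f x and f x₀ is dominated in the second.
  Dominating-split : ∀ {Q} (g : Vector ℚ n → Bool) → Dominating Q →
    ∃ λ b → Dominating (λ y → Q y × g y ≡ b)
  Dominating-split {Q} g dom
    with em {∃ λ x → Unit x × (∀ y → Unit y → Q y → g y ≡ true → ¬ (f x ℚ.≤ f y))}
  ... | yes (x₀ , ux₀ , undominated) = false , dominated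
    where
    inFalse : ∀ y → Unit y → Q y → f x₀ ℚ.≤ f y → g y ≡ false
    inFalse y uy qy fx₀≤fy with g y in eq
    ... | false = refl
    ... | true  = contradiction fx₀≤fy (undominated y uy qy eq)
    dominated : Dominating (λ y → Q y × g y ≡ false)
    dominated x ux with ℚ.≤-total (f x) (f x₀)
    ... | inj₁ fx≤fx₀ =
      let y , uy , qy , fx₀≤fy = dom x₀ ux₀
      in y , uy , (qy , inFalse y uy qy fx₀≤fy) , ℚ.≤-trans fx≤fx₀ fx₀≤fy
    ... | inj₂ fx₀≤fx =
      let y , uy , qy , fx≤fy = dom x ux
      in y , uy , (qy , inFalse y uy qy (ℚ.≤-trans fx₀≤fx fx≤fy)) , fx≤fy
  ... | no ¬undominated = true , dominated
    where
    dominated : Dominating (λ y → Q y × g y ≡ true)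
    -- The negated hypothesis yields only that a dominating point cannot fail to exist; this second
    -- appeal to excluded middle produces it.
    dominated x ux with em {∃ λ y → Unit y × (Q y × g y ≡ true) × f x ℚ.≤ f y}
    ... | yes found = found
    ... | no ¬found = contradiction
      (x , ux , λ y uy qy gy fx≤fy → ¬found (y , uy , (qy , gy) , fx≤fy)) ¬undominated

  Dominating-splitAll : ∀ {k Q} (g : Fin k → Vector ℚ n → Bool) → Dominating Q →
    ∃ λ (b : Fin k → Bool) → Dominating (λ y → Q y × (∀ i → g i y ≡ b i))
  Dominating-splitAll {zero}  g dom = (λ ()) , Dominating-map (λ _ qy → qy , λ ()) dom
  Dominating-splitAll {suc k} g dom =
    let b  , dom₁ = Dominating-split (g zero) dom
        bs , dom₂ = Dominating-splitAll (λ i → g (suc i)) dom₁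
    in (λ { zero → b ; (suc i) → bs i }) ,
       Dominating-map (λ { y ((qy , gy) , gys) → qy , λ { zero → gy ; (suc i) → gys i } }) dom₂

  Box : Vector ℚ n → ℚ → Vector ℚ n → Set
  Box c w y = ∀ i → c i ℚ.≤ y i × y i ℚ.≤ c i ℚ.+ w

  -- The `n` cuts are made one after another, each keeping domination, so that a single one of the
  -- 2ⁿ subboxes survives. A point on a cut counts as lower.
  halveBox : ∀ c w → 0ℚ ℚ.≤ ½ ℚ.* w → Dominating (Box c w) →
    ∃ λ c′ → Dominating (Box c′ (½ ℚ.* w)) ×
             (∀ i → c i ℚ.≤ c′ i × c′ i ℚ.+ ½ ℚ.* w ℚ.≤ c i ℚ.+ w)
  halveBox c w 0≤½w dom = c′ , Dominating-map inHalf (proj₂ split) , inside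
    where
    lower : Fin n → Vector ℚ n → Bool
    lower i y = does (y i ℚ.≤? c i ℚ.+ ½ ℚ.* w)
    split : ∃ λ (b : Fin n → Bool) → Dominating (λ y → Box c w y × (∀ i → lower i y ≡ b i))
    split = Dominating-splitAll lower dom
    b : Fin n → Bool
    b = proj₁ split
    corner : ℚ → Bool → ℚ
    corner p b = if b then p else p ℚ.+ ½ ℚ.* w
    c′ : Vector ℚ n
    c′ i = corner (c i) (b i)
    twoHalves : ∀ p → (p ℚ.+ ½ ℚ.* w) ℚ.+ ½ ℚ.* w ≡ p ℚ.+ w
    twoHalves p = trans (ℚ.+-assoc p (½ ℚ.* w) (½ ℚ.* w)) (cong (p ℚ.+_) (halves w))
    p≤p+½w : ∀ p → p ℚ.≤ p ℚ.+ ½ ℚ.* w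
    p≤p+½w p = subst (ℚ._≤ p ℚ.+ ½ ℚ.* w) (ℚ.+-identityʳ p) (ℚ.+-monoʳ-≤ p 0≤½w)
    inHalf : ∀ y → Box c w y × (∀ i → lower i y ≡ b i) → Box c′ (½ ℚ.* w) y
    inHalf y (y∈ , eqs) i =
      choose (y i ℚ.≤? c i ℚ.+ ½ ℚ.* w) (b i) (eqs i) (proj₁ (y∈ i)) (proj₂ (y∈ i))
      where
      choose : ∀ {p q} (p≤? : Dec (q ℚ.≤ p ℚ.+ ½ ℚ.* w)) b → does p≤? ≡ b →
               p ℚ.≤ q → q ℚ.≤ p ℚ.+ w → corner p b ℚ.≤ q × q ℚ.≤ corner p b ℚ.+ ½ ℚ.* w
      choose (yes q≤) true  _ p≤q q≤p+w = p≤q , q≤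
      choose {p} {q} (no ¬q≤) false _ p≤q q≤p+w =
        ℚ.<⇒≤ (ℚ.≰⇒> ¬q≤) , subst (q ℚ.≤_) (sym (twoHalves p)) q≤p+w
    inside : ∀ i → c i ℚ.≤ c′ i × c′ i ℚ.+ ½ ℚ.* w ℚ.≤ c i ℚ.+ w
    inside i with b i
    ... | true  = ℚ.≤-refl , subst (c i ℚ.+ ½ ℚ.* w ℚ.≤_) (twoHalves (c i)) (p≤p+½w (c i ℚ.+ ½ ℚ.* w))
    ... | false = p≤p+½w (c i) , ℚ.≤-reflexive (twoHalves (c i))

  boxes : ∀ k → ∃ λ c → Dominating (Box c (width k))
  boxes zero    = (λ _ → 0ℚ) , λ x ux → x , ux ,
    (λ i → proj₁ (ux i) , subst (x i ℚ.≤_) (sym (ℚ.+-identityˡ 1ℚ)) (proj₂ (ux i))) , ℚ.≤-refl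
  boxes (suc k) =
    let c , dom = boxes k
        c′ , dom′ , _ = halveBox c (width k) (ℚ.<⇒≤ (0<width (suc k))) dom
    in c′ , dom′

  corner : ℕ → Vector ℚ n
  corner k = proj₁ (boxes k)

  nested : ∀ k j i → corner k i ℚ.≤ corner (j ℕ.+ k) i ×
                     corner (j ℕ.+ k) i ℚ.+ width (j ℕ.+ k) ℚ.≤ corner k i ℚ.+ width k
  nested k zero    i = ℚ.≤-refl , ℚ.≤-refl
  nested k (suc j) i =
    let lo , hi = nested k j i
        c , dom = boxes (j ℕ.+ k)
        lo′ , hi′ = proj₂ (proj₂ (halveBox c (width (j ℕ.+ k)) (ℚ.<⇒≤ (0<width (suc (j ℕ.+ k)))) dom)) i
    in ℚ.≤-trans lo lo′ , ℚ.≤-trans hi′ hi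

  nested-≤ : ∀ {k m} → k ℕ.≤ m → ∀ i → corner k i ℚ.≤ corner m i ×
             corner m i ℚ.+ width m ℚ.≤ corner k i ℚ.+ width k
  nested-≤ {k} {m} k≤m i = subst
    (λ m → corner k i ℚ.≤ corner m i × corner m i ℚ.+ width m ℚ.≤ corner k i ℚ.+ width k)
    (ℕ.m∸n+n≡m k≤m) (nested k (m ℕ.∸ k) i)

  p≤p+width : ∀ p k → p ℚ.≤ p ℚ.+ width k
  p≤p+width p k = subst (ℚ._≤ p ℚ.+ width k) (ℚ.+-identityʳ p) (ℚ.+-monoʳ-≤ p (ℚ.<⇒≤ (0<width k)))

  -- Both corners lie in the `k`-th box, whose side is `width k`.
  corner-close : ∀ {k m l} → k ℕ.≤ m → k ℕ.≤ l → ∀ i → corner m i ℚ.≤ corner l i ℚ.+ width k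
  corner-close {k} {m} {l} k≤m k≤l i = begin
    corner m i                  ≤⟨ p≤p+width (corner m i) m ⟩
    corner m i ℚ.+ width m      ≤⟨ proj₂ (nested-≤ k≤m i) ⟩
    corner k i ℚ.+ width k      ≤⟨ ℚ.+-monoˡ-≤ (width k) (proj₁ (nested-≤ k≤l i)) ⟩
    corner l i ℚ.+ width k      ∎
    where open ℚ.≤-Reasoning

  maximizer : Vector ℝ n
  maximizer i = mkℝ (λ k → corner k i) λ ε 0<ε →
    let N , w≤½ε = width→0 (½ ℚ.* ε) (0<½*p 0<ε)
    in N , λ m l N≤m N≤l → ℚ.≤-<-trans
         (∣p-q∣≤⁺ (corner-close N≤m N≤l i) (corner-close N≤l N≤m i))
         (ℚ.≤-<-trans w≤½ε (½ε<ε ε 0<ε))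
    where
    ½ε<ε : ∀ ε → 0ℚ ℚ.< ε → ½ ℚ.* ε ℚ.< ε
    ½ε<ε ε 0<ε = subst₂ ℚ._<_ (ℚ.+-identityʳ (½ ℚ.* ε)) (halves ε)
      (ℚ.+-monoʳ-< (½ ℚ.* ε) (0<½*p 0<ε))

  maximizer-cube : Cube maximizer
  maximizer-cube i =
    (λ ε 0<ε → 0 , λ k _ → ℚ.≤-<-trans (proj₁ (nested-≤ {0} {k} ℕ.z≤n i)) (p<p+ε (corner k i) 0<ε)) ,
    (λ ε 0<ε → 0 , λ k _ → ℚ.≤-<-trans
      (ℚ.≤-trans (p≤p+width (corner k i) k) (proj₂ (nested-≤ {0} {k} ℕ.z≤n i)))
      (p<p+ε 1ℚ 0<ε))
    where
    p<p+ε : ∀ p {ε} → 0ℚ ℚ.< ε → p ℚ.< p ℚ.+ ε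
    p<p+ε p {ε} 0<ε = subst (ℚ._< p ℚ.+ ε) (ℚ.+-identityʳ p) (ℚ.+-monoʳ-< p 0<ε)

  module _ (f-lipschitz : Lipschitz f) where
    open Lipschitz f-lipschitz

    -- At a fixed large `m`, the term of `a` is moved to a point `c` of the cube within δ, `c` is
    -- dominated by some `y` in the `m`-th box, and `y` is within δ of the corner. The two moves
    -- cost `slope * δ` each, less than half of ε; in both, the point required to lie in the cube is
    -- available, namely `c` and then `y`.
    maximizer-dominates : ∀ a → Cube a → ∀ ε → 0ℚ ℚ.< ε →
      Eventually (λ m → f (λ i → seq (a i) m) ℚ.< f (corner m) ℚ.+ ε)
    maximizer-dominates a cube ε 0<ε = Eventually-zip compare
      (N , λ m N≤m → ℚ.≤-trans (width-antitone N≤m) wN≤δ)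
      (Eventually-∀ λ i → Eventually-zip (λ _ → _,_) (proj₁ (cube i) δ 0<δ) (proj₂ (cube i) δ 0<δ))
      where
      step : ∃ λ δ → 0ℚ ℚ.< δ × δ ℚ.≤ 1ℚ × slope ℚ.* δ ℚ.< ½ ℚ.* ε
      step = smallStep slope (½ ℚ.* ε) 0≤slope (0<½*p 0<ε)
      δ : ℚ
      δ = proj₁ step
      0<δ : 0ℚ ℚ.< δ
      0<δ = proj₁ (proj₂ step)
      δ≤1 : δ ℚ.≤ 1ℚ
      δ≤1 = proj₁ (proj₂ (proj₂ step))
      Kδ<½ε : slope ℚ.* δ ℚ.< ½ ℚ.* ε
      Kδ<½ε = proj₂ (proj₂ (proj₂ step))
      N : ℕ
      N = proj₁ (width→0 δ 0<δ)
      wN≤δ : width N ℚ.≤ δ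
      wN≤δ = proj₂ (width→0 δ 0<δ)
      width-antitone : ∀ {k m} → k ℕ.≤ m → width m ℚ.≤ width k
      width-antitone {k} {m} k≤m = subst (λ m → width m ℚ.≤ width k) (ℕ.m∸n+n≡m k≤m) (go (m ℕ.∸ k))
        where
        go : ∀ j → width (j ℕ.+ k) ℚ.≤ width k
        go zero    = ℚ.≤-refl
        go (suc j) = ℚ.≤-trans
          (subst (½ ℚ.* w ℚ.≤_) (halves w)
            (subst (ℚ._≤ ½ ℚ.* w ℚ.+ ½ ℚ.* w) (ℚ.+-identityʳ (½ ℚ.* w))
              (ℚ.+-monoʳ-≤ (½ ℚ.* w) (ℚ.<⇒≤ (0<width (suc (j ℕ.+ k)))))))
          (go j)
          where
          w : ℚ
          w = width (j ℕ.+ k)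
      compare : ∀ m → width m ℚ.≤ δ →
        (∀ i → 0ℚ ℚ.< seq (a i) m ℚ.+ δ × seq (a i) m ℚ.< 1ℚ ℚ.+ δ) →
        f (λ i → seq (a i) m) ℚ.< f (corner m) ℚ.+ ε
      compare m w≤δ nearCube = begin-strict
        f x                                    ≤⟨ ∣p-q∣≤⇒p≤q+ (subst (ℚ._≤ slope ℚ.* δ) (∣p-q∣≡∣q-p∣ (f c) (f x))
                                                    (lipschitz c (λ i → proj₁ (proj₂ (near i))) x δ (ℚ.<⇒≤ 0<δ) δ≤1 (λ i → proj₂ (proj₂ (near i))))) ⟩
        f c ℚ.+ slope ℚ.* δ                    ≤⟨ ℚ.+-monoˡ-≤ (slope ℚ.* δ) fc≤fy ⟩
        f y ℚ.+ slope ℚ.* δ                    ≤⟨ ℚ.+-monoˡ-≤ (slope ℚ.* δ) (∣p-q∣≤⇒p≤q+ {f y} {f z}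
                                                    (lipschitz y uy (corner m) δ (ℚ.<⇒≤ 0<δ) δ≤1 y-near)) ⟩
        (f z ℚ.+ slope ℚ.* δ) ℚ.+ slope ℚ.* δ  <⟨ ℚ.+-mono-< (ℚ.+-monoʳ-< (f z) Kδ<½ε) Kδ<½ε ⟩
        (f z ℚ.+ ½ ℚ.* ε) ℚ.+ ½ ℚ.* ε          ≡⟨ ℚ.+-assoc (f z) (½ ℚ.* ε) (½ ℚ.* ε) ⟩
        f z ℚ.+ (½ ℚ.* ε ℚ.+ ½ ℚ.* ε)          ≡⟨ cong (f z ℚ.+_) (halves ε) ⟩
        f z ℚ.+ ε                              ∎
        where
        open ℚ.≤-Reasoning
        x z : Vector ℚ n
        x i = seq (a i) m
        z = corner m
        near : ∀ i → ∃ λ p → (0ℚ ℚ.≤ p × p ℚ.≤ 1ℚ) × ℚ.∣ p ℚ.- x i ∣ ℚ.≤ δ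
        near i = nearestInUnit (x i) δ (ℚ.<⇒≤ 0<δ) (ℚ.<⇒≤ (proj₁ (nearCube i))) (ℚ.<⇒≤ (proj₂ (nearCube i)))
        c : Vector ℚ n
        c i = proj₁ (near i)
        dominator : ∃ λ y → Unit y × Box (corner m) (width m) y × f c ℚ.≤ f y
        dominator = proj₂ (boxes m) c (λ i → proj₁ (proj₂ (near i)))
        y : Vector ℚ n
        y = proj₁ dominator
        uy : Unit y
        uy = proj₁ (proj₂ dominator)
        y∈box : Box (corner m) (width m) y
        y∈box = proj₁ (proj₂ (proj₂ dominator))
        fc≤fy : f c ℚ.≤ f y
        fc≤fy = proj₂ (proj₂ (proj₂ dominator))
        y-near : ∀ i → ℚ.∣ y i ℚ.- z i ∣ ℚ.≤ δ
        y-near i = ℚ.≤-trans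
          (∣p-q∣≤⁺ (proj₂ (y∈box i)) (ℚ.≤-trans (proj₁ (y∈box i)) (p≤p+width (y i) m))) w≤δ

-- Derivatives of polynomials

∣eval∣≤ : ∀ p → ∃ λ B → 0ℚ ℚ.≤ B × (∀ x → ℚ.∣ x ∣ ℚ.≤ 1ℚ → ℚ.∣ eval p x ∣ ℚ.≤ B)
∣eval∣≤ []ˡ      = 0ℚ , ℚ.≤-refl , λ _ _ → ℚ.≤-refl
∣eval∣≤ (c ∷ˡ p) =
  let B , 0≤B , bound = ∣eval∣≤ p
  in ℚ.∣ fromℤ c ∣ ℚ.+ B , ℚ.+-mono-≤ (ℚ.0≤∣p∣ (fromℤ c)) 0≤B , λ x ∣x∣≤1 → begin
    ℚ.∣ fromℤ c ℚ.+ x ℚ.* eval p x ∣              ≤⟨ ℚ.∣p+q∣≤∣p∣+∣q∣ (fromℤ c) (x ℚ.* eval p x) ⟩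
    ℚ.∣ fromℤ c ∣ ℚ.+ ℚ.∣ x ℚ.* eval p x ∣        ≤⟨ ℚ.+-monoʳ-≤ ℚ.∣ fromℤ c ∣ (∣p*q∣≤ ∣x∣≤1 (bound x ∣x∣≤1)) ⟩
    ℚ.∣ fromℤ c ∣ ℚ.+ 1ℚ ℚ.* B                    ≡⟨ cong (ℚ.∣ fromℤ c ∣ ℚ.+_) (ℚ.*-identityˡ B) ⟩
    ℚ.∣ fromℤ c ∣ ℚ.+ B                           ∎
  where open ℚ.≤-Reasoning

-- The error term is exactly `eval q h * h * h`. With `B` a bound for `eval q` on [-1,1], it is at
-- most `B * δ * ∣ h ∣`, and δ is chosen so that `B * δ` stays below the rational `ε₀` that
-- witnesses `0ℝ < ε`.
eval-derivative-at-0 : ∀ (f : ℝ → ℝ) c₀ c₁ q →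
  (∀ x m → seq (f x) m ≡ eval (c₀ ∷ˡ c₁ ∷ˡ q) (seq x m)) →
  HasDerivativeAt f 0ℝ (fromℚ (c₁ ℚ./ 1))
eval-derivative-at-0 f c₀ c₁ q f≡ ε (ε₀ , 0<ε₀ , ε₀<ε) =
  fromℚ δ , (½ ℚ.* δ , 0<½*p 0<δ , 0 , λ _ _ → ½δ<δ) , close
  where
  B : ℚ
  B = proj₁ (∣eval∣≤ q)
  step : ∃ λ δ → 0ℚ ℚ.< δ × δ ℚ.≤ 1ℚ × B ℚ.* δ ℚ.< ε₀
  step = smallStep B ε₀ (proj₁ (proj₂ (∣eval∣≤ q))) 0<ε₀
  δ : ℚ
  δ = proj₁ step
  0<δ : 0ℚ ℚ.< δ
  0<δ = proj₁ (proj₂ step)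
  ½δ<δ : 0ℚ ℚ.+ ½ ℚ.* δ ℚ.< δ
  ½δ<δ = subst (0ℚ ℚ.+ ½ ℚ.* δ ℚ.<_) (halves δ) (ℚ.+-monoˡ-< (½ ℚ.* δ) (0<½*p 0<δ))

  remainder : ∀ c₀ c₁ h Q Q₀ →
    ((c₀ ℚ.+ h ℚ.* (c₁ ℚ.+ h ℚ.* Q)) ℚ.- (c₀ ℚ.+ 0ℚ ℚ.* Q₀)) ℚ.- c₁ ℚ.* h ≡ (Q ℚ.* h) ℚ.* h
  remainder = solve 5 (λ c₀ c₁ h Q Q₀ →
    ((c₀ :+ h :* (c₁ :+ h :* Q)) :- (c₀ :+ con 0ℚ :* Q₀)) :- c₁ :* h := (Q :* h) :* h) refl
    where open +-*-Solver

  close : ∀ h → ∣ h ∣ < fromℚ δ → ∣ (f (0ℝ + h) - f 0ℝ) - fromℚ (fromℤ c₁) * h ∣ ≤ ε * ∣ h ∣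
  close h (η , 0<η , h<δ) ε′ 0<ε′ = Eventually-zip estimate ε₀<ε h<δ
    where
    open ℚ.≤-Reasoning
    estimate : ∀ m → 0ℚ ℚ.+ ε₀ ℚ.< seq ε m → ℚ.∣ seq h m ∣ ℚ.+ η ℚ.< δ →
      ℚ.∣ (seq (f (0ℝ + h)) m ℚ.- seq (f 0ℝ) m) ℚ.- fromℤ c₁ ℚ.* seq h m ∣ ℚ.<
      seq ε m ℚ.* ℚ.∣ seq h m ∣ ℚ.+ ε′
    estimate m ε₀<εₘ hₘ+η<δ = begin-strict
      ℚ.∣ (seq (f (0ℝ + h)) m ℚ.- seq (f 0ℝ) m) ℚ.- fromℤ c₁ ℚ.* hₘ ∣
        ≡⟨ cong₂ (λ u v → ℚ.∣ (u ℚ.- v) ℚ.- fromℤ c₁ ℚ.* hₘ ∣)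
             (trans (f≡ (0ℝ + h) m) (cong (eval (c₀ ∷ˡ c₁ ∷ˡ q)) (ℚ.+-identityˡ hₘ))) (f≡ 0ℝ m) ⟩
      ℚ.∣ (eval (c₀ ∷ˡ c₁ ∷ˡ q) hₘ ℚ.- eval (c₀ ∷ˡ c₁ ∷ˡ q) 0ℚ) ℚ.- fromℤ c₁ ℚ.* hₘ ∣
        ≡⟨ cong ℚ.∣_∣ (remainder (fromℤ c₀) (fromℤ c₁) hₘ (eval q hₘ) (eval (c₁ ∷ˡ q) 0ℚ)) ⟩
      ℚ.∣ (eval q hₘ ℚ.* hₘ) ℚ.* hₘ ∣
        ≤⟨ ∣p*q∣≤ {eval q hₘ ℚ.* hₘ} (∣p*q∣≤ (proj₂ (proj₂ (∣eval∣≤ q)) hₘ (ℚ.≤-trans hₘ≤δ δ≤1)) hₘ≤δ) ℚ.≤-refl ⟩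
      (B ℚ.* δ) ℚ.* ℚ.∣ hₘ ∣
        ≤⟨ ℚ.*-monoʳ-≤-nonNeg ℚ.∣ hₘ ∣ {{ℚ.∣-∣-nonNeg hₘ}} (ℚ.<⇒≤ (ℚ.<-trans Bδ<ε₀ (subst (ℚ._< seq ε m) (ℚ.+-identityˡ ε₀) ε₀<εₘ))) ⟩
      seq ε m ℚ.* ℚ.∣ hₘ ∣
        ≡⟨ ℚ.+-identityʳ _ ⟨
      seq ε m ℚ.* ℚ.∣ hₘ ∣ ℚ.+ 0ℚ
        <⟨ ℚ.+-monoʳ-< (seq ε m ℚ.* ℚ.∣ hₘ ∣) 0<ε′ ⟩
      seq ε m ℚ.* ℚ.∣ hₘ ∣ ℚ.+ ε′
        ∎
      where
      hₘ : ℚ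
      hₘ = seq h m
      δ≤1 : δ ℚ.≤ 1ℚ
      δ≤1 = proj₁ (proj₂ (proj₂ step))
      Bδ<ε₀ : B ℚ.* δ ℚ.< ε₀
      Bδ<ε₀ = proj₂ (proj₂ (proj₂ step))
      hₘ≤δ : ℚ.∣ hₘ ∣ ℚ.≤ δ
      hₘ≤δ = ℚ.<⇒≤ (ℚ.≤-<-trans
        (subst (ℚ._≤ ℚ.∣ hₘ ∣ ℚ.+ η) (ℚ.+-identityʳ ℚ.∣ hₘ ∣) (ℚ.+-monoʳ-≤ ℚ.∣ hₘ ∣ (ℚ.<⇒≤ 0<η))) hₘ+η<δ)

-- The maxima over the vertices and over the cube

entry : Entry → ℝ → ℝ
entry O x = 0ℝ
entry I x = 1ℝ
entry X x = x

seq-entry : ∀ e x m → seq (entry e x) m ≡ value e (seq x m)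
seq-entry O x m = refl
seq-entry I x m = refl
seq-entry X x m = refl

-- The order on ℝ wants a margin that leaves a strict inequality, so the full gap `q - p` is too
-- large; a rational `s` strictly between supplies the margin `s - p`.
fromℚ<⁺ : ∀ {p q} x → p ℚ.< q → (∀ m → seq x m ≡ q) → fromℚ p < x
fromℚ<⁺ {p} {q} x p<q x≡q =
  let s , p<s , s<q = ℚ.<-dense p<q
  in s ℚ.- p ,
     subst (ℚ._< s ℚ.- p) (ℚ.+-inverseʳ p) (ℚ.+-monoˡ-< (ℚ.- p) p<s) ,
     0 , λ m _ → subst₂ ℚ._<_ (trans (sym (cancelSub s p)) (ℚ.+-comm (s ℚ.- p) p)) (sym (x≡q m)) s<q

toBit : ∀ x → x ≃ 0ℝ ⊎ x ≃ 1ℝ → Bool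
toBit x (inj₁ _) = false
toBit x (inj₂ _) = true

≃-bit : ∀ x (x≃ : x ≃ 0ℝ ⊎ x ≃ 1ℝ) → x ≃ fromℚ (bit (toBit x x≃))
≃-bit x (inj₁ x≃0) = x≃0
≃-bit x (inj₂ x≃1) = x≃1

vertex-bits : ∀ {n} (a : Vector ℝ n) → Vertex a →
  ∃ λ (v : Vec Bool n) → ∀ i → a i ≃ fromℚ (bit (lookup v i))
vertex-bits a vertex = tabulate bits , λ i →
  subst (λ b → a i ≃ fromℚ (bit b)) (sym (lookup∘tabulate bits i)) (≃-bit (a i) (vertex i))
  where
  bits : Fin _ → Bool
  bits i = toBit (a i) (vertex i)

bit-unit : ∀ b → 0ℚ ℚ.≤ bit b × bit b ℚ.≤ 1ℚ
bit-unit false = ℚ.≤-refl , ℚ.nonNegative⁻¹ 1ℚ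
bit-unit true  = ℚ.nonNegative⁻¹ 1ℚ , ℚ.≤-refl

module _ {n} .{{_ : NonZero n}} (d : ℕ) (every≤d : every n (boundedBy d) ≡ true) where

  -- The terms of the coordinates need not be 0 or 1, so the integer bound is reached only up to
  -- `slope * δ`, measured from the vector `y` of bits, which does lie in the cube.
  vertex-det≤ : ∀ (a : Vector ℝ n) → Vertex a → ∣ det (circ a) ∣ ≤ fromℚ (+ d ℚ./ 1)
  vertex-det≤ a vertex ε 0<ε =
    let v , a≃v = vertex-bits a vertex
        δ , 0<δ , δ≤1 , Kδ<ε = smallStep slope ε 0≤slope 0<ε
    in Eventually-map (λ m near → estimate v m (ℚ.<⇒≤ 0<δ) δ≤1 Kδ<ε λ i → ℚ.<⇒≤ (near i))
         (Eventually-∀ λ i → a≃v i δ 0<δ)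
    where
    open Lipschitz (absDet-lipschitz {n})
    open ℚ.≤-Reasoning
    estimate : ∀ v m {δ} → 0ℚ ℚ.≤ δ → δ ℚ.≤ 1ℚ → slope ℚ.* δ ℚ.< ε →
      (∀ i → ℚ.∣ seq (a i) m ℚ.- bit (lookup v i) ∣ ℚ.≤ δ) →
      seq ∣ det (circ a) ∣ m ℚ.< fromℤ (+ d) ℚ.+ ε
    estimate v m {δ} 0≤δ δ≤1 Kδ<ε near = begin-strict
      seq ∣ det (circ a) ∣ m               ≡⟨ seq-absDet a m ⟩
      absDet x                             ≤⟨ ∣p-q∣≤⇒p≤q+ (subst (ℚ._≤ slope ℚ.* δ) (∣p-q∣≡∣q-p∣ (absDet y) (absDet x))
                                                (lipschitz y (λ i → bit-unit (lookup v i)) x δ 0≤δ δ≤1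
                                                  (λ i → subst (ℚ._≤ δ) (∣p-q∣≡∣q-p∣ (x i) (y i)) (near i)))) ⟩
      absDet y ℚ.+ slope ℚ.* δ             <⟨ ℚ.+-mono-≤-< (∣det∣≤ d every≤d v) Kδ<ε ⟩
      fromℤ (+ d) ℚ.+ ε                    ∎
      where
      x y : Vector ℚ n
      x i = seq (a i) m
      y i = bit (lookup v i)

  private
    D : ℝ
    D = fromℚ (+ d ℚ./ 1)

    absDetℝ : Vector ℝ n → ℝ
    absDetℝ a = ∣ det (circ a) ∣

  isD₀₁ : (a : Vector ℝ n) → Vertex a → absDetℝ a ≃ D → IsD₀₁ n D
  isD₀₁ a vertex attained = (a , vertex , attained) , λ { v (b , vertex-b , b≃v) →
    ≤-trans v (absDetℝ b) D (≃⇒≤ v (absDetℝ b) (≃-sym (absDetℝ b) v b≃v)) (vertex-det≤ b vertex-b) }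

  cubeMaximumExceeds : (a : Vector ℝ n) → Cube a → D < absDetℝ a → CubeMaximumExceeds n D
  cubeMaximumExceeds a cube D<a =
    (a , cube , D<a) ,
    -- A maximum at a vertex `b` would give `absDetℝ a ≤ absDetℝ b ≤ D`, against `D < absDetℝ a`.
    -- This part is constructive.
    (λ { b vertex (_ , isUpper) → <⇒≱ D (absDetℝ a) D<a
      (≤-trans (absDetℝ a) (absDetℝ b) D
        (isUpper (absDetℝ a) (a , cube , ≃-refl (absDetℝ a))) (vertex-det≤ b vertex)) }) ,
    λ em →
      let open ExtremeValue em (absDet {n})
          M = absDetℝ maximizer
          dominates : ∀ b → Cube b → absDetℝ b ≤ M
          dominates b cube-b ε 0<ε = Eventually-map
            (λ m → subst₂ (λ p q → p ℚ.< q ℚ.+ ε) (sym (seq-absDet b m)) (sym (seq-absDet maximizer m)))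
            (maximizer-dominates absDet-lipschitz b cube-b ε 0<ε)
      in M ,
         ((maximizer , maximizer-cube , ≃-refl M) ,
          λ { v (b , cube-b , b≃v) → ≤-trans v (absDetℝ b) M
                (≃⇒≤ v (absDetℝ b) (≃-sym (absDetℝ b) v b≃v)) (dominates b cube-b) }) ,
         <-≤-trans D (absDetℝ a) M D<a (dominates a cube)

-- The rows of orders 9 and 10

row₉ : Vec Entry 9
row₉ = X ∷ᵛ O ∷ᵛ O ∷ᵛ I ∷ᵛ I ∷ᵛ I ∷ᵛ I ∷ᵛ O ∷ᵛ I ∷ᵛ []ᵛ

row₁₀ : Vec Entry 10
row₁₀ = X ∷ᵛ O ∷ᵛ I ∷ᵛ O ∷ᵛ O ∷ᵛ I ∷ᵛ I ∷ᵛ I ∷ᵛ I ∷ᵛ O ∷ᵛ []ᵛ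

-- Lowest degree first; `-[1+ 110 ]` stands for -111. As the variable fills the diagonal, these are
-- the characteristic polynomials of -A(0): monic, and without a term of degree n - 1 because A(0)
-- has trace 0. The constant terms are the two values of `D`, and the coefficient 9 is the
-- derivative asked for.
detPoly₉ detPoly₁₀ : Poly
detPoly₉  = + 95 ∷ˡ + 9 ∷ˡ + 18 ∷ˡ -[1+ 110 ] ∷ˡ + 27 ∷ˡ + 0 ∷ˡ + 33 ∷ˡ -[1+ 17 ] ∷ˡ + 0 ∷ˡ + 1 ∷ˡ []ˡ
detPoly₁₀ = + 275 ∷ˡ + 80 ∷ˡ -[1+ 369 ] ∷ˡ + 50 ∷ˡ + 205 ∷ˡ -[1+ 113 ] ∷ˡ -[1+ 29 ] ∷ˡ + 50 ∷ˡ -[1+ 14 ] ∷ˡ + 0 ∷ˡ + 1 ∷ˡ []ˡ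

circDetPoly-row₉ : circDetPoly row₉ ≡ detPoly₉
circDetPoly-row₉ = from-yes (List.≡-dec ℤ._≟_ (circDetPoly row₉) detPoly₉)

circDetPoly-row₁₀ : circDetPoly row₁₀ ≡ detPoly₁₀
circDetPoly-row₁₀ = from-yes (List.≡-dec ℤ._≟_ (circDetPoly row₁₀) detPoly₁₀)

-- Evaluates all 2⁹ determinants, and `every-10` all 2¹⁰. The bounds are sharp, being the constant
-- terms of the polynomials above.
every-9 : every 9 (boundedBy 95) ≡ true
every-9 = refl

every-10 : every 10 (boundedBy 275) ≡ true
every-10 = refl

-- The polynomial is a variable `p` with an equation, so that later goals speak of a list of
-- coefficients and not of an exterior product.
module _ {n} .{{_ : NonZero n}} (r : Vec Entry n) {p} (circDetPoly≡p : circDetPoly r ≡ p) where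

  private
    row : ℝ → Vector ℝ n
    row x i = entry (lookup r i) x

  module _ (A : ℝ → SquareMatrix ℝ n) (A≡circ : ∀ x i j → A x i j ≡ circ (row x) i j) where

    seq-det≡eval : ∀ x m → seq (det (A x)) m ≡ eval p (seq x m)
    seq-det≡eval x m = begin
      seq (det (A x)) m                                   ≡⟨ seq-det (A x) m ⟩
      detℚ (λ i j → seq (A x i j) m)                      ≡⟨ detℚ-cong {M = λ i j → seq (A x i j) m} seq-A ⟩
      detℚ (circ (λ i → value (lookup r i) (seq x m)))    ≡⟨ circDetPoly-correct (seq x m) r ⟨
      eval (circDetPoly r) (seq x m)                      ≡⟨ cong (λ p → eval p (seq x m)) circDetPoly≡p ⟩
      eval p (seq x m)                                    ∎
      where
      open ≡-Reasoning
      seq-A : ∀ i j → seq (A x i j) m ≡ circ (λ i → value (lookup r i) (seq x m)) i j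
      seq-A i j = trans (cong (λ y → seq y m) (A≡circ x i j)) (seq-entry (circ (lookup r) i j) x m)

    det-at-0 : ∀ d → eval p 0ℚ ≡ d → det (A 0ℝ) ≃ fromℚ d
    det-at-0 d eq = seq≡⇒≃ (det (A 0ℝ)) (fromℚ d) λ m → trans (seq-det≡eval 0ℝ m) eq

    ∣det∣-at-0 : ∀ d → ℚ.∣ eval p 0ℚ ∣ ≡ d → ∣ det (A 0ℝ) ∣ ≃ fromℚ d
    ∣det∣-at-0 d eq = seq≡⇒≃ ∣ det (A 0ℝ) ∣ (fromℚ d) λ m →
      trans (cong ℚ.∣_∣ (seq-det≡eval 0ℝ m)) eq

    derivative-at-0 : ∀ c₀ c₁ q → p ≡ c₀ ∷ˡ c₁ ∷ˡ q →
                      HasDerivativeAt (λ x → det (A x)) 0ℝ (fromℚ (c₁ / 1))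
    derivative-at-0 c₀ c₁ q p≡ = eval-derivative-at-0 (λ x → det (A x)) c₀ c₁ q λ x m →
      trans (seq-det≡eval x m) (cong (λ p → eval p (seq x m)) p≡)

    <det-at : ∀ b q → b ℚ.< eval p q → fromℚ b < det (A (fromℚ q))
    <det-at b q b< = fromℚ<⁺ (det (A (fromℚ q))) b< (seq-det≡eval (fromℚ q))

    <∣det∣-at : ∀ b q → b ℚ.< ℚ.∣ eval p q ∣ → fromℚ b < ∣ det (A (fromℚ q)) ∣
    <∣det∣-at b q b< = fromℚ<⁺ ∣ det (A (fromℚ q)) ∣ b< λ m →
      cong ℚ.∣_∣ (seq-det≡eval (fromℚ q) m)

  private
    row-vertex : Vertex (row 0ℝ)
    row-vertex i with lookup r i
    ... | O = inj₁ (≃-refl 0ℝ)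
    ... | I = inj₂ (≃-refl 1ℝ)
    ... | X = inj₁ (≃-refl 0ℝ)

    row-cube : ∀ {q} → 0ℚ ℚ.≤ q → q ℚ.≤ 1ℚ → Cube (row (fromℚ q))
    row-cube {q} 0≤q q≤1 i with lookup r i
    ... | O = fromℚ-mono-≤ ℚ.≤-refl , fromℚ-mono-≤ (ℚ.nonNegative⁻¹ 1ℚ)
    ... | I = fromℚ-mono-≤ (ℚ.nonNegative⁻¹ 1ℚ) , fromℚ-mono-≤ ℚ.≤-refl
    ... | X = fromℚ-mono-≤ 0≤q , fromℚ-mono-≤ q≤1

  isD₀₁-at-0 : ∀ d → every n (boundedBy d) ≡ true → ℚ.∣ eval p 0ℚ ∣ ≡ + d / 1 →
               IsD₀₁ n (fromℚ (+ d / 1))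
  isD₀₁-at-0 d every≤d eq = isD₀₁ d every≤d (row 0ℝ) row-vertex
    (∣det∣-at-0 (λ x → circ (row x)) (λ _ _ _ → refl) (+ d / 1) eq)

  cubeMaximumExceeds-at : ∀ d → every n (boundedBy d) ≡ true → ∀ q → 0ℚ ℚ.≤ q → q ℚ.≤ 1ℚ →
    + d / 1 ℚ.< ℚ.∣ eval p q ∣ → CubeMaximumExceeds n (fromℚ (+ d / 1))
  cubeMaximumExceeds-at d every≤d q 0≤q q≤1 d< =
    cubeMaximumExceeds d every≤d (row (fromℚ q)) (row-cube 0≤q q≤1)
      (<∣det∣-at (λ x → circ (row x)) (λ _ _ _ → refl) (+ d / 1) q d<)

-- A row written out as a functional vector agrees with `row₉` by computation only at a concrete
-- index, hence the enumeration.
entries₉ : ∀ x i → (x ∷ 0ℝ ∷ 0ℝ ∷ 1ℝ ∷ 1ℝ ∷ 1ℝ ∷ 1ℝ ∷ 0ℝ ∷ 1ℝ ∷ []) i ≡ entry (lookup row₉ i) x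
entries₉ x zero = refl
entries₉ x (suc zero) = refl
entries₉ x (suc (suc zero)) = refl
entries₉ x (suc (suc (suc zero))) = refl
entries₉ x (suc (suc (suc (suc zero)))) = refl
entries₉ x (suc (suc (suc (suc (suc zero))))) = refl
entries₉ x (suc (suc (suc (suc (suc (suc zero)))))) = refl
entries₉ x (suc (suc (suc (suc (suc (suc (suc zero))))))) = refl
entries₉ x (suc (suc (suc (suc (suc (suc (suc (suc zero)))))))) = refl

entries₁₀ : ∀ x i → (x ∷ 0ℝ ∷ 1ℝ ∷ 0ℝ ∷ 0ℝ ∷ 1ℝ ∷ 1ℝ ∷ 1ℝ ∷ 1ℝ ∷ 0ℝ ∷ []) i ≡ entry (lookup row₁₀ i) x
entries₁₀ x zero = refl
entries₁₀ x (suc zero) = refl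
entries₁₀ x (suc (suc zero)) = refl
entries₁₀ x (suc (suc (suc zero))) = refl
entries₁₀ x (suc (suc (suc (suc zero)))) = refl
entries₁₀ x (suc (suc (suc (suc (suc zero))))) = refl
entries₁₀ x (suc (suc (suc (suc (suc (suc zero)))))) = refl
entries₁₀ x (suc (suc (suc (suc (suc (suc (suc zero))))))) = refl
entries₁₀ x (suc (suc (suc (suc (suc (suc (suc (suc zero)))))))) = refl
entries₁₀ x (suc (suc (suc (suc (suc (suc (suc (suc (suc zero))))))))) = refl

mainTheorem2 :
  (let A : ℝ → SquareMatrix ℝ 9
       A x = circ (x ∷ 0ℝ ∷ 0ℝ ∷ 1ℝ ∷ 1ℝ ∷ 1ℝ ∷ 1ℝ ∷ 0ℝ ∷ 1ℝ ∷ [])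
   in ∃ λ (D : ℝ) → IsD₀₁ 9 D
      × det (A 0ℝ) ≃ fromℚ (+ 95 / 1)
      × fromℚ (+ 95 / 1) ≃ D
      × HasDerivativeAt (λ x → det (A x)) 0ℝ (fromℚ (+ 9 / 1))
      × fromℚ (+ 96757 / 1000) < ∣ det (A (fromℚ (+ 241 / 1000))) ∣
      × CubeMaximumExceeds 9 D)
  ×
  (let A : ℝ → SquareMatrix ℝ 10
       A x = circ (x ∷ 0ℝ ∷ 1ℝ ∷ 0ℝ ∷ 0ℝ ∷ 1ℝ ∷ 1ℝ ∷ 1ℝ ∷ 1ℝ ∷ 0ℝ ∷ [])
   in ∃ λ (D : ℝ) → IsD₀₁ 10 D
      × det (A 0ℝ) ≃ fromℚ (+ 275 / 1)
      × fromℚ (+ 275 / 1) ≃ D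
      × fromℚ (+ 2794 / 10) < det (A (fromℚ (+ 112 / 1000)))
      × CubeMaximumExceeds 10 D)
mainTheorem2 =
  -- The components are named first: checking them against the goal directly
  -- would unfold the determinants.
  (let A : ℝ → SquareMatrix ℝ 9
       A x = circ (x ∷ 0ℝ ∷ 0ℝ ∷ 1ℝ ∷ 1ℝ ∷ 1ℝ ∷ 1ℝ ∷ 0ℝ ∷ 1ℝ ∷ [])
       -- The argument is the index at which `circ` reads its first row for position `(i , j)`.
       A≡ = λ (x : ℝ) (i j : Fin 9) → entries₉ x (((9 ℕ.+ toℕ j) ℕ.∸ toℕ i) mod 9)
       -- Just above a critical point of the polynomial, near 0.2408.
       q = + 241 / 1000
       maximal = isD₀₁-at-0 row₉ circDetPoly-row₉ 95 every-9 refl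
       atZero = det-at-0 row₉ circDetPoly-row₉ A A≡ (+ 95 / 1) refl
       derivative = derivative-at-0 row₉ circDetPoly-row₉ A A≡ (+ 95) (+ 9) (List.drop 2 detPoly₉) refl
       large = <∣det∣-at row₉ circDetPoly-row₉ A A≡ (+ 96757 / 1000) q
         (from-yes ((+ 96757 / 1000) ℚ.<? ℚ.∣ eval detPoly₉ q ∣))
       exceeds = cubeMaximumExceeds-at row₉ circDetPoly-row₉ 95 every-9 q
         (from-yes (0ℚ ℚ.≤? q)) (from-yes (q ℚ.≤? 1ℚ))
         (from-yes ((+ 95 / 1) ℚ.<? ℚ.∣ eval detPoly₉ q ∣))
   in fromℚ (+ 95 / 1) , maximal , atZero , ≃-refl (fromℚ (+ 95 / 1)) , derivative , large , exceeds) ,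
  (let A : ℝ → SquareMatrix ℝ 10
       A x = circ (x ∷ 0ℝ ∷ 1ℝ ∷ 0ℝ ∷ 0ℝ ∷ 1ℝ ∷ 1ℝ ∷ 1ℝ ∷ 1ℝ ∷ 0ℝ ∷ [])
       A≡ = λ (x : ℝ) (i j : Fin 10) → entries₁₀ x (((10 ℕ.+ toℕ j) ℕ.∸ toℕ i) mod 10)
       -- Just below a critical point of the polynomial, near 0.1121.
       q = + 112 / 1000
       maximal = isD₀₁-at-0 row₁₀ circDetPoly-row₁₀ 275 every-10 refl
       atZero = det-at-0 row₁₀ circDetPoly-row₁₀ A A≡ (+ 275 / 1) refl
       large = <det-at row₁₀ circDetPoly-row₁₀ A A≡ (+ 2794 / 10) q
         (from-yes ((+ 2794 / 10) ℚ.<? eval detPoly₁₀ q))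
       exceeds = cubeMaximumExceeds-at row₁₀ circDetPoly-row₁₀ 275 every-10 q
         (from-yes (0ℚ ℚ.≤? q)) (from-yes (q ℚ.≤? 1ℚ))
         (from-yes ((+ 275 / 1) ℚ.<? ℚ.∣ eval detPoly₁₀ q ∣))
   in fromℚ (+ 275 / 1) , maximal , atZero , ≃-refl (fromℚ (+ 275 / 1)) , large , exceeds)
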